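{- For all integers $\ell \ge 3$, $\tilde{r}(P_4, P_{\ell+1}) = \lceil (7\ell+2)/5 \rceil$.
   Context: $P_n$ denotes a path on $n$ vertices. For graphs $G_1,G_2$, the $(G_1,G_2)$-online Ramsey game is played by Builder and Painter on an infinite set of vertices, initially with no edges. In each round Builder draws one edge between two currently nonadjacent vertices, and Painter immediately colors it red or blue. Builder wins once the colored graph contains a red copy of $G_1$ or a blue copy of $G_2$. The online Ramsey number $\tilde{r}(G_1,G_2)$ is the smallest number $N$ such that Builder has a strategy guaranteeing a win within $N$ rounds against every strategy of Painter. -}

module Defs where

open import Data.Nat using (ℕ; zero; suc; _≤_)
open import Data.Fin using (Fin; toℕ)
open import Data.List using (List; []; _∷_)
open import Data.List.Membership.Propositional using (_∈_)
open import Data.Product using (Σ; _×_)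
open import Data.Sum using (_⊎_)
open import Relation.Nullary using (¬_)
open import Relation.Binary.PropositionalEquality using (_≡_; _≢_)
open import Function.Definitions using (Injective)

data Colour : Set where
  red blue : Colour

-- A coloured edge between vertices u and v (vertex set = ℕ, infinite).
record ColouredEdge : Set where
  constructor edge
  field
    u v : ℕ
    c   : Colour

Board : Set
Board = List ColouredEdge

HasEdge : Board → Colour → ℕ → ℕ → Set
HasEdge b c x y = edge x y c ∈ b ⊎ edge y x c ∈ b

Adjacent : Board → ℕ → ℕ → Set
Adjacent b x y = Σ Colour λ c → HasEdge b c x y

record Graph : Set₁ where
  field
    size : ℕ
    adj  : Fin size → Fin size → Set

Path : ℕ → Graph
Path n = record
  { size = n
  ; adj  = λ i j → suc (toℕ i) ≡ toℕ j ⊎ suc (toℕ j) ≡ toℕ i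
  }

ContainsMono : Board → Colour → Graph → Set
ContainsMono b c G =
  Σ (Fin (Graph.size G) → ℕ) λ f →
    Injective _≡_ _≡_ f ×
    (∀ i j → Graph.adj G i j → HasEdge b c (f i) (f j))

BuilderHasWon : Graph → Graph → Board → Set
BuilderHasWon G₁ G₂ b = ContainsMono b red G₁ ⊎ ContainsMono b blue G₂

BuilderWinsWithin : Graph → Graph → ℕ → Board → Set
BuilderWinsWithin G₁ G₂ zero    b = BuilderHasWon G₁ G₂ b
BuilderWinsWithin G₁ G₂ (suc n) b =
  BuilderHasWon G₁ G₂ b ⊎
  Σ ℕ λ x → Σ ℕ λ y →
    x ≢ y × ¬ Adjacent b x y ×
    ((c : Colour) → BuilderWinsWithin G₁ G₂ n (edge x y c ∷ b))

IsOnlineRamseyNumber : Graph → Graph → ℕ → Set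
IsOnlineRamseyNumber G₁ G₂ N =
  BuilderWinsWithin G₁ G₂ N [] ×
  (∀ M → BuilderWinsWithin G₁ G₂ M [] → N ≤ M)

{-# OPTIONS --safe #-}

-- Lower bound.  Painter keeps the red graph a forest of stars and draws red whenever an
-- isolated vertex can be attached to another isolated vertex, to a single red edge or to the
-- centre of a star.  A blue edge then has a leaf of a star with at least two edges as an
-- end, or no isolated end.  Weigh leaves 8, centres 4 and ends of single red edges 5, so that
-- each red edge pays for at most 10.  A blue path on n ≥ 2 vertices has weight at least 4n,
-- possibly after adding one centre outside of it; hence 2n ≤ 5r for the number r of red edges.
--
-- Upper bound.  Up to what matters for the rest of the game, a position consists of the ends
-- of the blue paths drawn so far and some red edges near these ends.  A finite list of such
-- positions suffices: with m blue edges still to be drawn, position t can be won in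
-- ⌊(7m + c t)/5⌋ rounds once m is not small, because Builder has a move that increases c by at
-- most 2 if it is painted blue, and decreases c by at least 5 if it is painted red.  The
-- finitely many cases with small m have moves of their own.

module Submission where

open import Defs
open import Data.Bool using (true; false; if_then_else_)
open import Data.Empty using (⊥)
open import Data.Fin using (Fin; zero; suc; toℕ; inject≤)
open import Data.Fin.Properties using (inject≤-injective; toℕ-inject≤)
open import Data.List using (List; []; _∷_; _++_; length; lookup; filter; tabulate; upTo)
open import Data.List.Membership.Propositional using (_∈_; _∉_)
open import Data.List.Membership.Propositional.Properties using (∈-++⁺ˡ; ∈-++⁺ʳ; ∈-++⁻; ∈-filter⁺; ∈-lookup; ∈-upTo⁺)
open import Data.List.Properties using (++-assoc; filter-notAll; length-tabulate)
open import Data.List.Relation.Binary.Permutation.Propositional using (_↭_; ↭-refl; ↭-sym; ↭-trans; ↭⇒↭ₛ)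
open import Data.List.Relation.Binary.Permutation.Propositional.Properties using (++⁺; ++⁺ˡ; ++⁺ʳ; ++-comm; shifts; ∈-resp-↭)
open import Data.List.Relation.Binary.Subset.Propositional using (_⊆_)
open import Data.List.Relation.Unary.All as All using (All; []; _∷_; all?)
open import Data.List.Relation.Unary.All.Properties using (¬Any⇒All¬; All¬⇒¬Any)
open import Data.List.Relation.Unary.AllPairs using ([]; _∷_)
open import Data.List.Relation.Unary.Any as Any using (Any; here; there)
open import Data.List.Relation.Unary.Linked as Linked using (Linked; []; [-]; _∷_)
open import Data.List.Relation.Unary.Unique.Propositional using (Unique)
open import Data.Maybe using (Maybe; just; nothing; _>>=_; from-just)
open import Data.Nat using (ℕ; zero; suc; _+_; _*_; _∸_; _/_; _≤_; _<_; _≤?_; _<?_; z≤n; s≤s)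
open import Data.Nat.DivMod using (/-monoˡ-≤; m*n/n≡m; m/n≡1+[m∸n]/n; m≥n⇒m/n>0; +-distrib-/-∣ʳ)
open import Data.Nat.Divisibility using (divides)
open import Data.Nat.Properties
open import Data.Nat.Tactic.RingSolver using (solve-∀)
open import Data.Product using (Σ; ∃; ∃₂; _×_; _,_; _,′_; proj₁; proj₂)
open import Data.Product.Properties using (≡-dec)
open import Data.Sum as Sum using (_⊎_; inj₁; inj₂; [_,_]′; swap)
open import Data.Unit using (⊤; tt)
open import Function using (_∘_; case_of_; id)
open import Relation.Binary.PropositionalEquality
open import Relation.Nullary using (¬_; Dec; yes; no; does; contradiction; ¬?; _×-dec_; _⊎-dec_; _→-dec_)
open import Relation.Nullary.Decidable using (dec⇒maybe; dec-true; dec-false)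
import Data.List.Membership.DecPropositional as DecMembership
import Data.List.Relation.Binary.Permutation.Setoid.Properties as PermutationSetoid
import Data.List.Relation.Unary.Unique.Propositional.Properties as Unique
open import Data.List.Relation.Unary.Unique.DecPropositional _≟_ using (unique?)

open DecMembership _≟_ using (_∈?_)
open DecMembership (≡-dec _≟_ _≟_) using () renaming (_∈?_ to _∈²?_)

-- Edges of a board and the length of paths in one colour

HasEdge-∷ : ∀ {b c x y e} → HasEdge b c x y → HasEdge (e ∷ b) c x y
HasEdge-∷ = Sum.map there there

HasEdge-∷⁻ : ∀ {b c x y u v c′} → HasEdge (edge u v c′ ∷ b) c x y →
  HasEdge b c x y ⊎ (c ≡ c′ × (x ≡ u × y ≡ v ⊎ x ≡ v × y ≡ u))
HasEdge-∷⁻ (inj₁ (here refl)) = inj₂ (refl , inj₁ (refl , refl))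
HasEdge-∷⁻ (inj₁ (there p))   = inj₁ (inj₁ p)
HasEdge-∷⁻ (inj₂ (here refl)) = inj₂ (refl , inj₂ (refl , refl))
HasEdge-∷⁻ (inj₂ (there p))   = inj₁ (inj₂ p)

_≟ᶜ_ : (c d : Colour) → Dec (c ≡ d)
red  ≟ᶜ red  = yes refl
red  ≟ᶜ blue = no λ ()
blue ≟ᶜ red  = no λ ()
blue ≟ᶜ blue = yes refl

ofColour : Colour → Board → Board
ofColour c = filter (λ e → ColouredEdge.c e ≟ᶜ c)

length-ofColour : ∀ b → length (ofColour red b) + length (ofColour blue b) ≡ length b
length-ofColour []                  = refl
length-ofColour (edge _ _ red  ∷ b) = cong suc (length-ofColour b)
length-ofColour (edge _ _ blue ∷ b) = trans (+-suc _ _) (cong suc (length-ofColour b))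

HasEdge-ofColour : ∀ {b c x y} → HasEdge b c x y → HasEdge (ofColour c b) c x y
HasEdge-ofColour = Sum.map (λ p → ∈-filter⁺ _ p refl) (λ p → ∈-filter⁺ _ p refl)

Avoids : ℕ → ColouredEdge → Set
Avoids x e = ColouredEdge.u e ≢ x × ColouredEdge.v e ≢ x

avoids? : ∀ x e → Dec (Avoids x e)
avoids? x e = ¬? (ColouredEdge.u e ≟ x) ×-dec ¬? (ColouredEdge.v e ≟ x)

-- Discarding the first vertex with all edges at it removes at least one edge, and the rest of the
-- path survives because it never returns to that vertex.
linked-length : ∀ {c} b vs → Linked (HasEdge b c) vs → Unique vs → length vs ≤ suc (length b)
linked-length b [] _ _ = z≤n
linked-length b (x ∷ []) _ _ = s≤s z≤n
linked-length {c} b (x ∷ y ∷ vs) (xy ∷ l) (x∉ ∷ u) =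
  s≤s (≤-trans (linked-length _ (y ∷ vs) (restrict (y ∷ vs) l x∉) u) (filter-notAll (avoids? x) b (meets xy)))
  where
  meets : HasEdge b c x y → Any (λ e → ¬ Avoids x e) b
  meets (inj₁ p) = Any.map (λ { refl (q , _) → q refl }) p
  meets (inj₂ p) = Any.map (λ { refl (_ , q) → q refl }) p
  restrict : ∀ ws → Linked (HasEdge b c) ws → All (x ≢_) ws → Linked (HasEdge (filter (avoids? x) b) c) ws
  restrict _ [] _ = []
  restrict _ [-] _ = [-]
  restrict _ (e ∷ l) (p ∷ q ∷ ps) =
    Sum.map (λ i → ∈-filter⁺ (avoids? x) i (≢-sym p , ≢-sym q)) (λ i → ∈-filter⁺ (avoids? x) i (≢-sym q , ≢-sym p)) e
    ∷ restrict _ l (q ∷ ps)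

tabulate-linked : ∀ {R : ℕ → ℕ → Set} n (f : Fin n → ℕ) →
  (∀ i j → suc (toℕ i) ≡ toℕ j → R (f i) (f j)) → Linked R (tabulate f)
tabulate-linked zero f r = []
tabulate-linked (suc zero) f r = [-]
tabulate-linked (suc (suc n)) f r =
  r zero (suc zero) refl ∷ tabulate-linked (suc n) (f ∘ suc) (λ i j e → r (suc i) (suc j) (cong suc e))

-- Weights of vertices

infixl 9 _[_≔_]

_[_≔_] : {A : Set} → (ℕ → A) → ℕ → A → ℕ → A
(f [ x ≔ a ]) z with z ≟ x
... | yes _ = a
... | no  _ = f z

≔-same : {A : Set} (f : ℕ → A) (x : ℕ) {a : A} → (f [ x ≔ a ]) x ≡ a
≔-same f x with x ≟ x
... | yes _ = refl
... | no ¬p = contradiction refl ¬p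

≔-other : {A : Set} (f : ℕ → A) {x z : ℕ} {a : A} → z ≢ x → (f [ x ≔ a ]) z ≡ f z
≔-other f {x} {z} z≢x with z ≟ x
... | yes p = contradiction p z≢x
... | no  _ = refl

total : (ℕ → ℕ) → List ℕ → ℕ
total τ []       = 0
total τ (v ∷ vs) = τ v + total τ vs

-- This bounds the sum of `τ` over the infinite vertex set without naming the support of `τ`.
Bounded : (ℕ → ℕ) → ℕ → Set
Bounded τ n = ∀ vs → Unique vs → total τ vs ≤ n

total-cong : ∀ {τ υ} vs → All (λ v → τ v ≡ υ v) vs → total τ vs ≡ total υ vs
total-cong [] _ = refl
total-cong (v ∷ vs) (e ∷ es) = cong₂ _+_ e (total-cong vs es)

Bounded-cong : ∀ {τ υ n} → (∀ v → τ v ≡ υ v) → Bounded τ n → Bounded υ n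
Bounded-cong {n = n} e β vs u = subst (_≤ n) (total-cong vs (All.universal e vs)) (β vs u)

total-≔-∉ : ∀ {τ x d} vs → All (x ≢_) vs → total (τ [ x ≔ d ]) vs ≡ total τ vs
total-≔-∉ {τ} vs x∉ = total-cong vs (All.map (λ p → ≔-other τ (≢-sym p)) x∉)

total-≔-∈ : ∀ {τ x d} vs → Unique vs → x ∈ vs → total (τ [ x ≔ d ]) vs + τ x ≡ total τ vs + d
total-≔-∈ {τ} {x} {d} (_ ∷ vs) (x∉ ∷ u) (here refl)
  rewrite ≔-same τ x {d} | total-≔-∉ {τ} {x} {d} vs x∉ =
  rearrange d (total τ vs) (τ x)
  where
  rearrange : ∀ d t w → d + t + w ≡ w + t + d
  rearrange = solve-∀
total-≔-∈ {τ} {x} {d} (v ∷ vs) (v∉ ∷ u) (there x∈) rewrite ≔-other τ {x} {v} {d} (All.lookup v∉ x∈) =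
  trans (+-assoc (τ v) _ _) (trans (cong (τ v +_) (total-≔-∈ vs u x∈)) (sym (+-assoc (τ v) _ _)))

-- When x is not listed, the old weight of x is still available: add x to the list.
Bounded-≔ : ∀ {τ n} x d m → n + d ≤ m + τ x → Bounded τ n → Bounded (τ [ x ≔ d ]) m
Bounded-≔ {τ} {n} x d m le β vs u with x ∈? vs
... | yes x∈ = +-cancelʳ-≤ (τ x) _ _ (≤-trans (≤-reflexive (total-≔-∈ vs u x∈)) (≤-trans (+-monoˡ-≤ d (β vs u)) le))
... | no x∉ = +-cancelʳ-≤ (τ x) _ _ (begin
  total (τ [ x ≔ d ]) vs + τ x ≡⟨ cong (_+ τ x) (total-≔-∉ vs fresh) ⟩
  total τ vs + τ x             ≡⟨ +-comm _ (τ x) ⟩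
  τ x + total τ vs             ≤⟨ β (x ∷ vs) (fresh ∷ u) ⟩
  n                            ≤⟨ m≤m+n n d ⟩
  n + d                        ≤⟨ le ⟩
  m + τ x                      ∎)
  where
  open ≤-Reasoning
  fresh = ¬Any⇒All¬ vs x∉

-- Painter's strategy

-- A paired vertex is an end of a red component with one edge; the stars of centres and leaves
-- have at least two.  The hub of a paired vertex or leaf is its only red neighbour.
data Role : Set where
  isolated paired centre leaf : Role

weight : Role → ℕ
weight isolated = 0
weight paired   = 5
weight centre   = 4
weight leaf     = 8

Pendant : Role → Set
Pendant isolated = ⊥
Pendant paired   = ⊤
Pendant centre   = ⊥
Pendant leaf     = ⊤

weight-≔ : ∀ {role : ℕ → Role} {x r} v → ((weight ∘ role) [ x ≔ weight r ]) v ≡ weight ((role [ x ≔ r ]) v)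
weight-≔ {x = x} v with v ≟ x
... | yes _ = refl
... | no  _ = refl

Bounded-role : ∀ {role : ℕ → Role} {n} x r m → n + weight r ≤ m + weight (role x) →
  Bounded (weight ∘ role) n → Bounded (weight ∘ (role [ x ≔ r ])) m
Bounded-role {role} x r m le β = Bounded-cong (weight-≔ {role}) (Bounded-≔ {weight ∘ role} x (weight r) m le β)

pendant≢isolated : ∀ {r} → Pendant r → r ≢ isolated
pendant≢isolated p refl = p

HubFits : (ℕ → Role) → (ℕ → ℕ) → ℕ → Role → Set
HubFits role hub v isolated = ⊤
HubFits role hub v paired   = role (hub v) ≡ paired × hub (hub v) ≡ v × hub v ≢ v
HubFits role hub v centre   = ⊤
HubFits role hub v leaf     = role (hub v) ≡ centre

HangsOn : (ℕ → Role) → (ℕ → ℕ) → ℕ → ℕ → Set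
HangsOn role hub x y = Pendant (role x) × hub x ≡ y

Settled : (ℕ → Role) → ℕ → ℕ → Set
Settled role x y = role x ≡ leaf ⊎ role y ≡ leaf ⊎ (role x ≢ isolated × role y ≢ isolated)

-- Stars are encoded by pointers from pendant vertices to their hubs, so no component ever has to be
-- computed, and a centre stores no list of its leaves.
record StarForest (b : Board) : Set where
  field
    role    : ℕ → Role
    hub     : ℕ → ℕ
    hubFits : ∀ v → HubFits role hub v (role v)
    redEdge : ∀ {x y} → HasEdge b red x y → HangsOn role hub x y ⊎ HangsOn role hub y x
    blueEdge : ∀ {x y} → HasEdge b blue x y → Settled role x y
    bounded : Bounded (weight ∘ role) (10 * length (ofColour red b))

cons-≤ : ∀ w n t → 4 ≤ w → 4 * n ≤ t → 4 * suc n ≤ w + t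
cons-≤ w n t p q = subst (_≤ w + t) (sym (*-suc 4 n)) (+-mono-≤ p q)

module _ {b} (s : StarForest b) where
  open StarForest s

  no-second-edge : ∀ {x y z} → HangsOn role hub y z → x ≢ z → ¬ HasEdge b red x y
  no-second-edge {x} {y} {z} (pend , hub≡) x≢z e with redEdge e
  ... | inj₂ (_ , hub≡x) = x≢z (trans (sym hub≡x) hub≡)
  ... | inj₁ (pend′ , refl) with role x | hubFits x | pend′
  ... | paired | (_ , hub² , _) | _ = x≢z (trans (sym hub²) hub≡)
  ... | leaf   | isCentre   | _ = subst Pendant isCentre pend

  -- The middle edge of such a path has a pendant end, and by `no-second-edge` that end cannot also
  -- carry an outer edge of the path.
  no-red-P₄ : ¬ ContainsMono b red (Path 4)
  no-red-P₄ (f , inj , e) with redEdge (e (suc zero) (suc (suc zero)) (inj₁ refl))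
  ... | inj₁ h = no-second-edge h (λ p → case inj p of λ ()) (e zero (suc zero) (inj₁ refl))
  ... | inj₂ h = no-second-edge h (λ p → case inj p of λ ()) (e (suc (suc (suc zero))) (suc (suc zero)) (inj₂ refl))

  private τ = weight ∘ role

  -- Only an alternation of isolated vertices and leaves can fall short of weight 4 per vertex.
  Estimate : Role → List ℕ → Set
  Estimate isolated vs = 4 * length vs ≤ total τ vs ⊎
                         (4 * length vs ≤ total τ vs + 4 × All (λ v → role v ≢ centre) vs)
  Estimate leaf     vs = 4 * length vs + 4 ≤ total τ vs ⊎
                         (4 * length vs ≤ total τ vs × All (λ v → role v ≢ centre) vs)
  Estimate _        vs = 4 * length vs ≤ total τ vs

  non-isolated : ∀ r {vs} → Estimate r vs → r ≢ isolated → 4 * length vs ≤ total τ vs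
  non-isolated isolated e n = contradiction refl n
  non-isolated paired e n = e
  non-isolated centre e n = e
  non-isolated leaf (inj₁ e) n = ≤-trans (m≤m+n _ 4) e
  non-isolated leaf (inj₂ (e , _)) n = e

  -- A vertex that is paired or a centre pays for itself and is never followed by an isolated one.
  -- An isolated vertex can only be followed by a leaf, and the weight 8 of a leaf pays for itself
  -- and for one isolated neighbour. So a deficit arises only at an isolated start, and it is passed
  -- on only through isolated vertices and leaves.
  estimate : ∀ x vs → Linked (Settled role) (x ∷ vs) → Estimate (role x) (x ∷ vs)
  estimate x [] _ with role x in eq
  ... | isolated rewrite eq = inj₂ (≤-refl , (λ q → case trans (sym eq) q of λ ()) ∷ [])
  ... | paired rewrite eq = ≤ᵇ⇒≤ 4 5 tt
  ... | centre rewrite eq = ≤-refl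
  ... | leaf rewrite eq = inj₁ ≤-refl
  estimate x (y ∷ vs) (xy ∷ l) with role x in eqx | estimate y vs l
  ... | isolated | ih rewrite eqx = next xy
    where
    ws = y ∷ vs
    Goal = 4 * suc (length ws) ≤ total τ ws ⊎
           (4 * suc (length ws) ≤ total τ ws + 4 × All (λ v → role v ≢ centre) (x ∷ ws))
    go : Estimate leaf ws → Goal
    go (inj₁ e) = inj₁ (≤-trans (≤-reflexive (trans (*-suc 4 (length ws)) (+-comm 4 _))) e)
    go (inj₂ (e , a)) = inj₂
      ( ≤-trans (cons-≤ 4 (length ws) _ ≤-refl e) (≤-reflexive (+-comm 4 _))
      , (λ q → case trans (sym eqx) q of λ ()) ∷ a)
    next : isolated ≡ leaf ⊎ role y ≡ leaf ⊎ (isolated ≢ isolated × role y ≢ isolated) → Goal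
    next (inj₂ (inj₁ isLeaf)) = go (subst (λ r → Estimate r ws) isLeaf ih)
    next (inj₂ (inj₂ (q , _))) = contradiction refl q
  estimate x (y ∷ vs) (xy ∷ l) | paired | ih rewrite eqx =
    cons-≤ 5 (suc (length vs)) _ (≤ᵇ⇒≤ 4 5 tt) (non-isolated (role y) ih (next xy))
    where
    next : paired ≡ leaf ⊎ role y ≡ leaf ⊎ (paired ≢ isolated × role y ≢ isolated) → role y ≢ isolated
    next (inj₂ (inj₁ q)) r = case trans (sym q) r of λ ()
    next (inj₂ (inj₂ (_ , q))) = q
  estimate x (y ∷ vs) (xy ∷ l) | centre | ih rewrite eqx =
    cons-≤ 4 (suc (length vs)) _ ≤-refl (non-isolated (role y) ih (next xy))
    where
    next : centre ≡ leaf ⊎ role y ≡ leaf ⊎ (centre ≢ isolated × role y ≢ isolated) → role y ≢ isolated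
    next (inj₂ (inj₁ q)) r = case trans (sym q) r of λ ()
    next (inj₂ (inj₂ (_ , q))) = q
  estimate x (y ∷ vs) (xy ∷ l) | leaf | ih rewrite eqx = go (role y) refl ih
    where
    ws = y ∷ vs
    tally : 4 * length ws ≤ total τ ws → 4 * suc (length ws) + 4 ≤ 8 + total τ ws
    tally e = ≤-trans (≤-reflexive (+-comm _ 4)) (+-monoʳ-≤ 4 (cons-≤ 4 (length ws) _ ≤-refl e))
    go : ∀ r → role y ≡ r → Estimate r ws →
         4 * suc (length ws) + 4 ≤ 8 + total τ ws ⊎
         (4 * suc (length ws) ≤ 8 + total τ ws × All (λ v → role v ≢ centre) (x ∷ ws))
    go isolated _ (inj₁ e) = inj₁ (tally e)
    go isolated _ (inj₂ (e , a)) = inj₂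
      ( ≤-trans (cons-≤ 4 (length ws) _ ≤-refl e) (≤-reflexive (cong (4 +_) (+-comm _ 4)))
      , (λ q → case trans (sym eqx) q of λ ()) ∷ a)
    go paired _ e = inj₁ (tally e)
    go centre _ e = inj₁ (tally e)
    go leaf _ e = inj₁ (tally (non-isolated leaf e λ ()))

  -- The first edge matters: an isolated vertex alone weighs nothing, but if the path starts with
  -- one, the next vertex is a leaf, and the star of this leaf makes up for a deficit.
  path-weight : ∀ x y vs → Linked (Settled role) (x ∷ y ∷ vs) → Unique (x ∷ y ∷ vs) →
    4 * length (x ∷ y ∷ vs) ≤ 10 * length (ofColour red b)
  path-weight x y vs l u = go (role x) refl (estimate x (y ∷ vs) l) l
    where
    ws = x ∷ y ∷ vs
    go : ∀ r → role x ≡ r → Estimate r ws → Linked (Settled role) ws → 4 * length ws ≤ 10 * length (ofColour red b)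
    go paired _ e _ = ≤-trans e (bounded ws u)
    go centre _ e _ = ≤-trans e (bounded ws u)
    go leaf _ e _ = ≤-trans (non-isolated leaf e λ ()) (bounded ws u)
    go isolated _ (inj₁ e) _ = ≤-trans e (bounded ws u)
    go isolated eq (inj₂ (e , noCentre)) (inj₁ q ∷ _) = case trans (sym eq) q of λ ()
    go isolated eq (inj₂ (e , noCentre)) (inj₂ (inj₂ (q , _)) ∷ _) = contradiction eq q
    -- The path has no centre, so the hub of the leaf `y` lies outside it. Its weight 4 is exactly
    -- the possible deficit.
    go isolated eq (inj₂ (e , noCentre)) (inj₂ (inj₁ isLeaf) ∷ _) = ≤-trans e (begin
      total τ ws + 4                     ≡⟨ +-comm _ 4 ⟩
      4 + total τ ws                     ≡⟨ cong (λ r → weight r + total τ ws) (sym isCentre) ⟩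
      total τ (hub y ∷ ws)               ≤⟨ bounded (hub y ∷ ws) (outside ∷ u) ⟩
      10 * length (ofColour red b)       ∎)
      where
      open ≤-Reasoning
      isCentre : role (hub y) ≡ centre
      isCentre = subst (HubFits role hub y) isLeaf (hubFits y)
      outside : All (hub y ≢_) ws
      outside = ¬Any⇒All¬ ws (λ h → All.lookup noCentre h isCentre)

StarForest-[] : StarForest []
StarForest-[] = record
  { role     = λ _ → isolated
  ; hub      = λ _ → 0
  ; hubFits  = λ _ → tt
  ; redEdge  = λ { (inj₁ ()) ; (inj₂ ()) }
  ; blueEdge = λ { (inj₁ ()) ; (inj₂ ()) }
  ; bounded  = λ vs _ → ≤-reflexive (zeros vs)
  }
  where
  zeros : ∀ vs → total (λ _ → 0) vs ≡ 0
  zeros [] = refl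
  zeros (_ ∷ vs) = zeros vs

-- The painting lemmas expect the isolated end first; this serves the moves drawn the other way
-- round.
StarForest-flip : ∀ {b x y} c → StarForest (edge y x c ∷ b) → StarForest (edge x y c ∷ b)
StarForest-flip {b} {x} {y} c s = record
  { role     = role
  ; hub      = hub
  ; hubFits  = hubFits
  ; redEdge  = redEdge ∘ flip
  ; blueEdge = blueEdge ∘ flip
  ; bounded  = subst (λ n → Bounded (weight ∘ role) (10 * n)) (reds c) bounded
  }
  where
  open StarForest s
  flip : ∀ {d u v} → HasEdge (edge x y c ∷ b) d u v → HasEdge (edge y x c ∷ b) d u v
  flip e with HasEdge-∷⁻ e
  ... | inj₁ e′                           = HasEdge-∷ e′
  ... | inj₂ (refl , inj₁ (refl , refl)) = inj₂ (here refl)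
  ... | inj₂ (refl , inj₂ (refl , refl)) = inj₁ (here refl)
  reds : ∀ c → length (ofColour red (edge y x c ∷ b)) ≡ length (ofColour red (edge x y c ∷ b))
  reds red  = refl
  reds blue = refl

module _ {b} (s : StarForest b) where
  open StarForest s

  paintBlue : ∀ {x y} → Settled role x y → StarForest (edge x y blue ∷ b)
  paintBlue {x} {y} xy = record
    { role     = role
    ; hub      = hub
    ; hubFits  = hubFits
    ; redEdge  = λ e → case HasEdge-∷⁻ e of λ { (inj₁ e′) → redEdge e′ ; (inj₂ (() , _)) }
    ; blueEdge = λ e → case HasEdge-∷⁻ e of λ
        { (inj₁ e′) → blueEdge e′
        ; (inj₂ (_ , inj₁ (refl , refl))) → xy
        ; (inj₂ (_ , inj₂ (refl , refl))) → mirror xy }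
    ; bounded  = bounded
    }
    where
    mirror : Settled role x y → Settled role y x
    mirror (inj₁ p) = inj₂ (inj₁ p)
    mirror (inj₂ (inj₁ p)) = inj₁ p
    mirror (inj₂ (inj₂ (p , q))) = inj₂ (inj₂ (q , p))

  -- All red answers pass through here. The fifth premise lets an old red edge change its direction,
  -- as happens when an end of a single edge becomes a centre. The next two keep old blue edges
  -- settled: leaves stay leaves, and no vertex becomes isolated again.
  paintRed : ∀ {x y} role′ hub′ →
    (∀ v → HubFits role′ hub′ v (role′ v)) →
    HangsOn role′ hub′ x y →
    (∀ u → Pendant (role u) → HangsOn role′ hub′ u (hub u) ⊎ HangsOn role′ hub′ (hub u) u) →
    (∀ v → role v ≡ leaf → role′ v ≡ leaf) →
    (∀ v → role v ≢ isolated → role′ v ≢ isolated) →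
    Bounded (weight ∘ role′) (10 + 10 * length (ofColour red b)) →
    StarForest (edge x y red ∷ b)
  paintRed {x} {y} role′ hub′ fits new old leaves used bound = record
    { role     = role′
    ; hub      = hub′
    ; hubFits  = fits
    ; redEdge  = λ e → case HasEdge-∷⁻ e of λ
        { (inj₁ e′) → keep (redEdge e′)
        ; (inj₂ (_ , inj₁ (refl , refl))) → inj₁ new
        ; (inj₂ (_ , inj₂ (refl , refl))) → inj₂ new }
    ; blueEdge = λ e → case HasEdge-∷⁻ e of λ { (inj₁ e′) → settle (blueEdge e′) ; (inj₂ (() , _)) }
    ; bounded  = subst (Bounded (weight ∘ role′)) (sym (*-suc 10 _)) bound
    }
    where
    keep : ∀ {u v} → HangsOn role hub u v ⊎ HangsOn role hub v u → HangsOn role′ hub′ u v ⊎ HangsOn role′ hub′ v u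
    keep (inj₁ (p , refl)) = old _ p
    keep (inj₂ (p , refl)) = swap (old _ p)
    settle : ∀ {u v} → Settled role u v → Settled role′ u v
    settle (inj₁ p) = inj₁ (leaves _ p)
    settle (inj₂ (inj₁ p)) = inj₂ (inj₁ (leaves _ p))
    settle (inj₂ (inj₂ (p , q))) = inj₂ (inj₂ (used _ p , used _ q))

  differ : ∀ {u v} {r : Role} → role u ≡ r → role v ≢ r → u ≢ v
  differ p q refl = q p

  -- The hub of a pendant vertex is not isolated, so changes at formerly isolated vertices cannot
  -- disturb it. The caller answers only for non-isolated hubs.
  fits-transfer : ∀ {role′ hub′ v} r → HubFits role hub v r → hub′ v ≡ hub v →
    (Pendant r → role (hub v) ≢ isolated → role′ (hub v) ≡ role (hub v) × hub′ (hub v) ≡ hub (hub v)) →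
    HubFits role′ hub′ v r
  fits-transfer isolated f h t = tt
  fits-transfer centre f h t = tt
  fits-transfer {role′} {hub′} {v} paired (p , q , n) h t =
    trans (cong role′ h) (trans (proj₁ t′) p) , trans (cong hub′ h) (trans (proj₂ t′) q) , λ e → n (trans (sym h) e)
    where t′ = t tt (λ r → case trans (sym p) r of λ ())
  fits-transfer {role′} {hub′} {v} leaf p h t = trans (cong role′ h) (trans (proj₁ t′) p)
    where t′ = t tt (λ r → case trans (sym p) r of λ ())

  paint-isolated-isolated : ∀ {x y} → x ≢ y → role x ≡ isolated → role y ≡ isolated → StarForest (edge x y red ∷ b)
  paint-isolated-isolated {x} {y} x≢y rx ry = paintRed role′ hub′ fits
    (subst Pendant (sym role′x) tt , hub′x) old
    (λ v p → trans (unchangedʳ (λ q → case trans (sym p) q of λ ())) p)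
    (λ v p q → p (trans (sym (unchangedʳ p)) q))
    (Bounded-role {role [ x ≔ paired ]} y paired (10 + N) (step₂ (cong weight (trans (≔-other role (≢-sym x≢y)) ry)))
      (Bounded-role {role} x paired (5 + N) (step₁ (cong weight rx)) bounded))
    where
    N = 10 * length (ofColour red b)
    step₁ : ∀ {w} → w ≡ 0 → N + 5 ≤ 5 + N + w
    step₁ refl = ≤-reflexive (trans (+-comm N 5) (sym (+-identityʳ _)))
    step₂ : ∀ {w} → w ≡ 0 → 5 + N + 5 ≤ 10 + N + w
    step₂ refl = ≤-reflexive (shift N)
      where
      shift : ∀ n → 5 + n + 5 ≡ 10 + n + 0
      shift = solve-∀
    role′ = role [ x ≔ paired ] [ y ≔ paired ]
    hub′  = hub [ x ≔ y ] [ y ≔ x ]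
    role′x : role′ x ≡ paired
    role′x = trans (≔-other (role [ x ≔ paired ]) x≢y) (≔-same role x)
    role′y : role′ y ≡ paired
    role′y = ≔-same (role [ x ≔ paired ]) y
    hub′x : hub′ x ≡ y
    hub′x = trans (≔-other (hub [ x ≔ y ]) x≢y) (≔-same hub x)
    hub′y : hub′ y ≡ x
    hub′y = ≔-same (hub [ x ≔ y ]) y
    unchangedʳ : ∀ {w} → role w ≢ isolated → role′ w ≡ role w
    unchangedʳ p = trans (≔-other (role [ x ≔ paired ]) (≢-sym (differ ry p))) (≔-other role (≢-sym (differ rx p)))
    unchangedʰ : ∀ {w} → role w ≢ isolated → hub′ w ≡ hub w
    unchangedʰ p = trans (≔-other (hub [ x ≔ y ]) (≢-sym (differ ry p))) (≔-other hub (≢-sym (differ rx p)))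
    old : ∀ u → Pendant (role u) → HangsOn role′ hub′ u (hub u) ⊎ HangsOn role′ hub′ (hub u) u
    old u p = inj₁ (subst Pendant (sym (unchangedʳ (pendant≢isolated p))) p , unchangedʰ (pendant≢isolated p))
    fits : ∀ v → HubFits role′ hub′ v (role′ v)
    fits v = case (v ≟ x) ,′ (v ≟ y) of λ
      { (yes refl , _) → subst (HubFits role′ hub′ x) (sym role′x)
          (trans (cong role′ hub′x) role′y , trans (cong hub′ hub′x) hub′y , λ e → x≢y (trans (sym e) hub′x))
      ; (no _ , yes refl) → subst (HubFits role′ hub′ y) (sym role′y)
          (trans (cong role′ hub′y) role′x , trans (cong hub′ hub′y) hub′x , λ e → x≢y (trans (sym hub′y) e))
      ; (no v≢x , no v≢y) → subst (HubFits role′ hub′ v)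
          (sym (trans (≔-other (role [ x ≔ paired ]) v≢y) (≔-other role v≢x)))
          (fits-transfer (role v) (hubFits v) (trans (≔-other (hub [ x ≔ y ]) v≢y) (≔-other hub v≢x))
            (λ _ p → unchangedʳ p , unchangedʰ p)) }

  paint-isolated-centre : ∀ {x y} → x ≢ y → role x ≡ isolated → role y ≡ centre → StarForest (edge x y red ∷ b)
  paint-isolated-centre {x} {y} x≢y rx ry = paintRed role′ hub′ fits
    (subst Pendant (sym (≔-same role x)) tt , ≔-same hub x) old
    (λ v p → trans (unchangedʳ (λ q → case trans (sym p) q of λ ())) p)
    (λ v p q → p (trans (sym (unchangedʳ p)) q))
    (Bounded-role {role} x leaf (10 + N) (≤-trans step (m≤m+n _ _)) bounded)
    where
    N = 10 * length (ofColour red b)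
    step : N + 8 ≤ 10 + N
    step = ≤-trans (+-monoʳ-≤ N (≤ᵇ⇒≤ 8 10 tt)) (≤-reflexive (+-comm N 10))
    role′ = role [ x ≔ leaf ]
    hub′  = hub [ x ≔ y ]
    unchangedʳ : ∀ {w} → role w ≢ isolated → role′ w ≡ role w
    unchangedʳ p = ≔-other role (≢-sym (differ rx p))
    unchangedʰ : ∀ {w} → role w ≢ isolated → hub′ w ≡ hub w
    unchangedʰ p = ≔-other hub (≢-sym (differ rx p))
    old : ∀ u → Pendant (role u) → HangsOn role′ hub′ u (hub u) ⊎ HangsOn role′ hub′ (hub u) u
    old u p = inj₁ (subst Pendant (sym (unchangedʳ (pendant≢isolated p))) p , unchangedʰ (pendant≢isolated p))
    fits : ∀ v → HubFits role′ hub′ v (role′ v)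
    fits v = case v ≟ x of λ
      { (yes refl) → subst (HubFits role′ hub′ x) (sym (≔-same role x))
          (trans (cong role′ (≔-same hub x)) (trans (≔-other role (≢-sym x≢y)) ry))
      ; (no v≢x) → subst (HubFits role′ hub′ v) (sym (≔-other role v≢x))
          (fits-transfer (role v) (hubFits v) (≔-other hub v≢x) (λ _ p → unchangedʳ p , unchangedʰ p)) }

  paint-isolated-paired : ∀ {x y} → x ≢ y → role x ≡ isolated → role y ≡ paired → StarForest (edge x y red ∷ b)
  paint-isolated-paired {x} {y} x≢y rx ry = paintRed role′ hub′ fits
    (subst Pendant (sym role′x) tt , hub′x) old leaves used bound
    where
    N = 10 * length (ofColour red b)
    p = hub y
    partner = subst (HubFits role hub y) ry (hubFits y)
    rp : role p ≡ paired
    rp = proj₁ partner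
    hp : hub p ≡ y
    hp = proj₁ (proj₂ partner)
    p≢y : p ≢ y
    p≢y = proj₂ (proj₂ partner)
    p≢x : p ≢ x
    p≢x = differ rp (λ q → case trans (sym rx) q of λ ())
    role₁ = role [ p ≔ leaf ]
    role₂ = role₁ [ y ≔ centre ]
    role′ = role₂ [ x ≔ leaf ]
    hub′  = hub [ x ≔ y ]
    role₁y : role₁ y ≡ paired
    role₁y = trans (≔-other role (≢-sym p≢y)) ry
    role₂x : role₂ x ≡ isolated
    role₂x = trans (≔-other role₁ x≢y) (trans (≔-other role (≢-sym p≢x)) rx)
    role′x : role′ x ≡ leaf
    role′x = ≔-same role₂ x
    role′y : role′ y ≡ centre
    role′y = trans (≔-other role₂ (≢-sym x≢y)) (≔-same role₁ y)
    role′p : role′ p ≡ leaf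
    role′p = trans (≔-other role₂ p≢x) (trans (≔-other role₁ p≢y) (≔-same role p))
    hub′x : hub′ x ≡ y
    hub′x = ≔-same hub x
    unchanged : ∀ {w} → w ≢ x → w ≢ y → w ≢ p → role′ w ≡ role w
    unchanged p q r = trans (≔-other role₂ p) (trans (≔-other role₁ q) (≔-other role r))
    leaves : ∀ v → role v ≡ leaf → role′ v ≡ leaf
    leaves v e = trans (unchanged
      (differ e (λ q → case trans (sym rx) q of λ ()))
      (differ e (λ q → case trans (sym ry) q of λ ()))
      (differ e (λ q → case trans (sym rp) q of λ ()))) e
    used : ∀ v → role v ≢ isolated → role′ v ≢ isolated
    used v n e = case (v ≟ x) ,′ (v ≟ y) ,′ (v ≟ p) of λ
      { (yes refl , _) → n rx
      ; (no _ , yes refl , _) → case trans (sym role′y) e of λ ()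
      ; (no _ , no _ , yes refl) → case trans (sym role′p) e of λ ()
      ; (no i , no j , no k) → n (trans (sym (unchanged i j k)) e) }
    old : ∀ u → Pendant (role u) → HangsOn role′ hub′ u (hub u) ⊎ HangsOn role′ hub′ (hub u) u
    old u pend = case (u ≟ y) ,′ (u ≟ p) of λ
      -- The ends of a single edge are hubs of each other. Now that `y` is a centre, their edge is
      -- recorded by `p` alone.
      { (yes refl , _) → inj₂ (subst Pendant (sym role′p) tt , trans (≔-other hub p≢x) hp)
      ; (no _ , yes refl) → inj₁ (subst Pendant (sym role′p) tt , ≔-other hub p≢x)
      ; (no j , no k) → inj₁ (subst Pendant (sym (unchanged u≢x j k)) pend , ≔-other hub u≢x) }
      where
      u≢x : u ≢ x
      u≢x e = pendant≢isolated pend (trans (cong role e) rx)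
    fits : ∀ v → HubFits role′ hub′ v (role′ v)
    fits v = case (v ≟ x) ,′ (v ≟ y) ,′ (v ≟ p) of λ
      { (yes refl , _) → subst (HubFits role′ hub′ x) (sym role′x) (trans (cong role′ hub′x) role′y)
      ; (no _ , yes refl , _) → subst (HubFits role′ hub′ y) (sym role′y) tt
      ; (no _ , no _ , yes refl) → subst (HubFits role′ hub′ p) (sym role′p)
          (trans (cong role′ (trans (≔-other hub p≢x) hp)) role′y)
      ; (no i , no j , no k) → subst (HubFits role′ hub′ v) (sym (unchanged i j k))
          (fits-transfer (role v) (hubFits v) (≔-other hub i) (λ pend n →
            let hv≢x = λ e → n (trans (cong role e) rx) in
            unchanged hv≢x (hub≢y v k pend) (hub≢p v j pend) , ≔-other hub hv≢x)) }
      where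
      -- No vertex outside the pair `y`, `p` has its hub in it: the hub of a leaf is a centre, and a
      -- paired vertex is determined by its hub. Hence the hubs of all other vertices keep their
      -- roles.
      hub≢paired : ∀ v w → role w ≡ paired → v ≢ hub w → Pendant (role v) → hub v ≢ w
      hub≢paired v w rw v≢ pend e = go (role v) pend (hubFits v)
        where
        go : ∀ r → Pendant r → HubFits role hub v r → ⊥
        go paired _ (_ , q , _) = v≢ (trans (sym q) (cong hub e))
        go leaf _ q = case trans (sym q) (trans (cong role e) rw) of λ ()
      hub≢y : ∀ v → v ≢ p → Pendant (role v) → hub v ≢ y
      hub≢y v v≢p = hub≢paired v y ry v≢p
      hub≢p : ∀ v → v ≢ y → Pendant (role v) → hub v ≢ p
      hub≢p v v≢y = hub≢paired v p rp (λ e → v≢y (trans e hp))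
    bound : Bounded (weight ∘ role′) (10 + N)
    -- The partner goes from 5 to 8, `y` from 5 to 4 and `x` from 0 to 8. The sum of the changes is
    -- exactly the 10 paid by the new edge.
    bound = Bounded-role {role₂} x leaf (10 + N) (step₃ (cong weight role₂x))
      (Bounded-role {role₁} y centre (2 + N) (step₂ (cong weight role₁y))
        (Bounded-role {role} p leaf (3 + N) (step₁ (cong weight rp)) bounded))
      where
      step₁ : ∀ {w} → w ≡ 5 → N + 8 ≤ 3 + N + w
      step₁ refl = ≤-reflexive (+-comm-8 N)
        where
        +-comm-8 : ∀ n → n + 8 ≡ 3 + n + 5
        +-comm-8 = solve-∀
      step₂ : ∀ {w} → w ≡ 5 → 3 + N + 4 ≤ 2 + N + w
      step₂ refl = ≤-reflexive (shift N)
        where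
        shift : ∀ n → 3 + n + 4 ≡ 2 + n + 5
        shift = solve-∀
      step₃ : ∀ {w} → w ≡ 0 → 2 + N + 8 ≤ 10 + N + w
      step₃ refl = ≤-reflexive (shift N)
        where
        shift : ∀ n → 2 + n + 8 ≡ 10 + n + 0
        shift = solve-∀

  both : ∀ {x y r q} → role x ≡ r → role y ≡ q → r ≢ isolated → q ≢ isolated → Settled role x y
  both rx ry n m = inj₂ (inj₂ ((λ e → n (trans (sym rx) e)) , (λ e → m (trans (sym ry) e))))

  respond : ∀ x y → x ≢ y → Σ Colour λ c → StarForest (edge x y c ∷ b)
  respond x y x≢y with role x in rx | role y in ry
  ... | leaf     | _        = blue , paintBlue (inj₁ rx)
  ... | _        | leaf     = blue , paintBlue (inj₂ (inj₁ ry))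
  ... | isolated | isolated = red , paint-isolated-isolated x≢y rx ry
  ... | isolated | paired   = red , paint-isolated-paired x≢y rx ry
  ... | isolated | centre   = red , paint-isolated-centre x≢y rx ry
  ... | paired   | isolated = red , StarForest-flip red (paint-isolated-paired (≢-sym x≢y) ry rx)
  ... | centre   | isolated = red , StarForest-flip red (paint-isolated-centre (≢-sym x≢y) ry rx)
  ... | paired   | paired   = blue , paintBlue (both rx ry (λ ()) (λ ()))
  ... | paired   | centre   = blue , paintBlue (both rx ry (λ ()) (λ ()))
  ... | centre   | paired   = blue , paintBlue (both rx ry (λ ()) (λ ()))
  ... | centre   | centre   = blue , paintBlue (both rx ry (λ ()) (λ ()))

-- Counting edges for the lower bound

module _ (ℓ : ℕ) (3≤ℓ : 3 ≤ ℓ) where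

  -- With `R` red and `B` blue edges, the weights give 5R ≥ 2(ℓ + 1), and the path itself gives B ≥
  -- ℓ. Hence 5(R + B) ≥ 7ℓ + 2, and adding 4 before the division turns the floor into a ceiling.
  won-length : ∀ {b} → StarForest b → BuilderHasWon (Path 4) (Path (suc ℓ)) b → (7 * ℓ + 2 + 4) / 5 ≤ length b
  won-length s (inj₁ p₄) = contradiction p₄ (no-red-P₄ s)
  won-length {b} s (inj₂ (f , inj , e)) = begin
    (7 * ℓ + 2 + 4) / 5               ≤⟨ /-monoˡ-≤ 5 count ⟩
    (length b * 5 + 4) / 5            ≡⟨ [n*5+4]/5≡n (length b) ⟩
    length b                          ∎
    where
    open ≤-Reasoning
    open StarForest s
    vs = tabulate f
    link = tabulate-linked (suc ℓ) f (λ i j q → e i j (inj₁ q))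
    u = Unique.tabulate⁺ inj
    R = length (ofColour red b)
    B = length (ofColour blue b)
    ℓ≤B : ℓ ≤ B
    ℓ≤B = ≤-pred (≤-trans (≤-reflexive (sym (length-tabulate f)))
      (linked-length (ofColour blue b) vs (Linked.map HasEdge-ofColour link) u))
    weigh : ∀ ws → 2 ≤ length ws → Linked (Settled role) ws → Unique ws → 4 * length ws ≤ 10 * R
    weigh (x ∷ y ∷ ws) _ = path-weight s x y ws
    weigh (_ ∷ []) (s≤s ())
    2≤length : 2 ≤ length vs
    2≤length = subst (2 ≤_) (sym (length-tabulate f)) (s≤s (≤-trans (s≤s z≤n) 3≤ℓ))
    2ℓ≤5R : 2 * suc ℓ ≤ 5 * R
    2ℓ≤5R = *-cancelˡ-≤ 2 (begin
      2 * (2 * suc ℓ)   ≡⟨ sym (*-assoc 2 2 (suc ℓ)) ⟩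
      4 * suc ℓ         ≡⟨ cong (4 *_) (sym (length-tabulate f)) ⟩
      4 * length vs     ≤⟨ weigh vs 2≤length (Linked.map blueEdge link) u ⟩
      10 * R            ≡⟨ *-assoc 2 5 R ⟩
      2 * (5 * R)       ∎)
    count : 7 * ℓ + 2 + 4 ≤ length b * 5 + 4
    count = begin
      7 * ℓ + 2 + 4           ≡⟨ split ℓ ⟩
      2 * suc ℓ + 5 * ℓ + 4   ≤⟨ +-monoˡ-≤ 4 (+-mono-≤ 2ℓ≤5R (*-monoʳ-≤ 5 ℓ≤B)) ⟩
      5 * R + 5 * B + 4       ≡⟨ cong (_+ 4) (sym (*-distribˡ-+ 5 R B)) ⟩
      5 * (R + B) + 4         ≡⟨ cong (λ n → 5 * n + 4) (length-ofColour b) ⟩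
      5 * length b + 4        ≡⟨ cong (_+ 4) (*-comm 5 (length b)) ⟩
      length b * 5 + 4        ∎
      where
      split : ∀ ℓ → 7 * ℓ + 2 + 4 ≡ 2 * (1 + ℓ) + 5 * ℓ + 4
      split = solve-∀
    [n*5+4]/5≡n : ∀ n → (n * 5 + 4) / 5 ≡ n
    [n*5+4]/5≡n n = trans (cong (_/ 5) (+-comm (n * 5) 4)) (trans ([m+kn]/n 4 n) refl)
      where
      [m+kn]/n : ∀ m k → (m + k * 5) / 5 ≡ m / 5 + k
      [m+kn]/n m k = trans (+-distrib-/-∣ʳ m {k * 5} {5} (divides k refl)) (cong (m / 5 +_) (m*n/n≡m k 5))

  -- Each round moves one unit from the remaining rounds to the board, so the right-hand side is
  -- constant during play.
  painter-survives : ∀ n b → StarForest b → BuilderWinsWithin (Path 4) (Path (suc ℓ)) n b →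
    (7 * ℓ + 2 + 4) / 5 ≤ n + length b
  painter-survives zero b s w = won-length s w
  painter-survives (suc n) b s (inj₁ w) = ≤-trans (won-length s w) (m≤n+m _ (suc n))
  painter-survives (suc n) b s (inj₂ (x , y , x≢y , _ , k)) with respond s x y x≢y
  ... | c , s′ = ≤-trans (painter-survives n (edge x y c ∷ b) s′ (k c)) (≤-reflexive (+-suc n (length b)))

  lower-bound : ∀ M → BuilderWinsWithin (Path 4) (Path (suc ℓ)) M [] → (7 * ℓ + 2 + 4) / 5 ≤ M
  lower-bound M w = subst ((7 * ℓ + 2 + 4) / 5 ≤_) (+-identityʳ M) (painter-survives M [] StarForest-[] w)

-- Lists without repetition

Unique-resp-↭ : ∀ {xs ys : List ℕ} → xs ↭ ys → Unique xs → Unique ys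
Unique-resp-↭ p = PermutationSetoid.Unique-resp-↭ (setoid ℕ) (↭⇒↭ₛ p)

Unique-++ˡ : ∀ xs {ys : List ℕ} → Unique (xs ++ ys) → Unique xs
Unique-++ˡ [] u = []
Unique-++ˡ (x ∷ xs) (x∉ ∷ u) =
  ¬Any⇒All¬ xs (All¬⇒¬Any x∉ ∘ ∈-++⁺ˡ) ∷ Unique-++ˡ xs u

Unique-++ʳ : ∀ xs {ys : List ℕ} → Unique (xs ++ ys) → Unique ys
Unique-++ʳ [] u = u
Unique-++ʳ (x ∷ xs) (_ ∷ u) = Unique-++ʳ xs u

Unique-++-⊆ : ∀ xs {ys zs : List ℕ} → Unique (xs ++ ys) → Unique zs → zs ⊆ ys → Unique (xs ++ zs)
Unique-++-⊆ [] _ v _ = v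
Unique-++-⊆ (x ∷ xs) (x∉ ∷ u) v zs⊆ys =
  ¬Any⇒All¬ _ (λ i → All¬⇒¬Any x∉ ([ ∈-++⁺ˡ , ∈-++⁺ʳ xs ∘ zs⊆ys ]′ (∈-++⁻ xs i))) ∷ Unique-++-⊆ xs u v zs⊆ys

lookup-injective : ∀ {xs : List ℕ} → Unique xs → ∀ i j → lookup xs i ≡ lookup xs j → i ≡ j
lookup-injective (_ ∷ u) zero zero _ = refl
lookup-injective {x ∷ xs} (x∉ ∷ u) zero (suc j) e = contradiction e (All.lookup x∉ (∈-lookup j))
lookup-injective {x ∷ xs} (x∉ ∷ u) (suc i) zero e = contradiction (sym e) (All.lookup x∉ (∈-lookup i))
lookup-injective (_ ∷ u) (suc i) (suc j) e = cong suc (lookup-injective u i j e)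

Adjacent-∷⁻ : ∀ {b x y u v c} → Adjacent (edge u v c ∷ b) x y → Adjacent b x y ⊎ (x ≡ u × y ≡ v ⊎ x ≡ v × y ≡ u)
Adjacent-∷⁻ (d , e) = Sum.map (d ,_) proj₂ (HasEdge-∷⁻ e)

-- Blue paths

data BluePath (b : Board) : ℕ → ℕ → List ℕ → ℕ → Set where
  [-] : ∀ {x} → BluePath b x x (x ∷ []) 0
  _∷_ : ∀ {x y z vs k} → HasEdge b blue x y → BluePath b y z vs k → BluePath b x z (x ∷ vs) (suc k)

module _ {b : Board} where

  BluePath-∷ : ∀ {e x y vs k} → BluePath b x y vs k → BluePath (e ∷ b) x y vs k
  BluePath-∷ [-] = [-]
  BluePath-∷ (e ∷ p) = HasEdge-∷ e ∷ BluePath-∷ p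

  join : ∀ {x y z w vs ws k l} → BluePath b x y vs k → HasEdge b blue y z → BluePath b z w ws l →
    BluePath b x w (vs ++ ws) (suc (k + l))
  join [-] e q = e ∷ q
  join (d ∷ p) e q = d ∷ join p e q

  reversed : ∀ {x y vs k} → BluePath b x y vs k → ∃ λ ws → ws ↭ vs × BluePath b y x ws k
  reversed [-] = _ , ↭-refl , [-]
  reversed {x} {k = suc k} (e ∷ p) with reversed p
  ... | ws , perm , q = ws ++ x ∷ [] , ↭-trans (++-comm ws (x ∷ [])) (++⁺ˡ (x ∷ []) perm) ,
    subst (BluePath b _ x _) (cong suc (+-identityʳ k)) (join q (swap e) [-])

  end∈ : ∀ {x y vs k} → BluePath b x y vs k → y ∈ vs
  end∈ [-] = here refl
  end∈ (_ ∷ p) = there (end∈ p)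

  closed-path : ∀ {x vs k} → BluePath b x x vs k → Unique vs → k ≡ 0
  closed-path [-] _ = refl
  closed-path (_ ∷ p) (x∉ ∷ _) = contradiction refl (All.lookup x∉ (end∈ p))

  BluePath-length : ∀ {x y vs k} → BluePath b x y vs k → length vs ≡ suc k
  BluePath-length [-] = refl
  BluePath-length (_ ∷ p) = cong suc (BluePath-length p)

  BluePath-lookup : ∀ {x y vs k} → BluePath b x y vs k → ∀ i j → suc (toℕ i) ≡ toℕ j →
    HasEdge b blue (lookup vs i) (lookup vs j)
  BluePath-lookup (e ∷ [-]) zero (suc zero) _ = e
  BluePath-lookup (e ∷ _ ∷ _) zero (suc zero) _ = e
  BluePath-lookup (_ ∷ p) (suc i) (suc j) q = BluePath-lookup p i j (suc-injective q)
  BluePath-lookup [-] zero zero ()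

  BluePath⇒Path : ∀ {x y vs k} ℓ → BluePath b x y vs k → Unique vs → ℓ ≤ k → ContainsMono b blue (Path (suc ℓ))
  BluePath⇒Path {vs = vs} ℓ p u ℓ≤k =
    -- Builder may overshoot: only the first ℓ + 1 vertices of the path are taken.
    (λ i → lookup vs (inject≤ i le)) ,
    (λ {i} {j} e → inject≤-injective le le i j (lookup-injective u _ _ e)) ,
    λ { i j (inj₁ q) → forward i j q ; i j (inj₂ q) → swap (forward j i q) }
    where
    le : suc ℓ ≤ length vs
    le = ≤-trans (s≤s ℓ≤k) (≤-reflexive (sym (BluePath-length p)))
    forward : ∀ i j → suc (toℕ i) ≡ toℕ j → HasEdge b blue (lookup vs (inject≤ i le)) (lookup vs (inject≤ j le))
    forward i j q = BluePath-lookup p _ _ (trans (cong suc (toℕ-inject≤ i le)) (trans q (sym (toℕ-inject≤ j le))))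

-- Patterns

Pairs : Set
Pairs = List (ℕ × ℕ)

ends : Pairs → List ℕ
ends []             = []
ends ((i , j) ∷ ps) = i ∷ j ∷ ends ps

Joined : Pairs → ℕ → ℕ → Set
Joined es i j = (i , j) ∈ es ⊎ (j , i) ∈ es

joined? : ∀ es i j → Dec (Joined es i j)
joined? es i j = ((i , j) ∈²? es) ⊎-dec ((j , i) ∈²? es)

-- A pattern describes part of a board through labels.  Each pair in paths stands for the two
-- ends of a blue path (a single vertex if they coincide), reds lists red edges, labels from
-- size on are vertices not touched yet, and only ends joined in ties may be adjacent.
record Pattern : Set where
  constructor mkPattern
  field
    size  : ℕ
    paths : Pairs
    reds  : Pairs
    ties  : Pairs
open Pattern

-- The vertices of all paths form one list, so that its uniqueness makes every path simple and the
-- paths disjoint. The last index counts the blue edges of all paths together.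
data Family (b : Board) (σ : ℕ → ℕ) : Pairs → List ℕ → ℕ → Set where
  []  : Family b σ [] [] 0
  _∷_ : ∀ {i j ps vs ws k n} → BluePath b (σ i) (σ j) vs k → Family b σ ps ws n →
        Family b σ ((i , j) ∷ ps) (vs ++ ws) (k + n)

RedEdges : Board → (ℕ → ℕ) → Pairs → Set
RedEdges b σ = All (λ (i , j) → HasEdge b red (σ i) (σ j))

Joined-red : ∀ {b} (σ : ℕ → ℕ) {es i j} → RedEdges b σ es → Joined es i j → HasEdge b red (σ i) (σ j)
Joined-red σ all (inj₁ p) = All.lookup all p
Joined-red {b} σ all (inj₂ p) = swap (All.lookup all p)

-- As `σ` is defined on all labels, those from `size P` on are an inexhaustible supply of untouched
-- vertices. Adjacency is controlled at the ends of paths, because Builder joins only such ends.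
record Realises (b : Board) (σ : ℕ → ℕ) (P : Pattern) (n : ℕ) : Set where
  field
    injective : ∀ {i j} → σ i ≡ σ j → i ≡ j
    vertices  : List ℕ
    family    : Family b σ (paths P) vertices n
    unique    : Unique vertices
    redEdges  : RedEdges b σ (reds P)
    unused    : ∀ {i} → size P ≤ i → σ i ∉ vertices
    fresh     : ∀ {i} → size P ≤ i → ∀ y → ¬ Adjacent b (σ i) y
    apart     : ∀ {i j} → i ∈ ends (paths P) → j ∈ ends (paths P) → Adjacent b (σ i) (σ j) → Joined (ties P) i j

data Pluck : Pairs → ℕ → ℕ → Pairs → Set where
  first  : ∀ {i j ps} → Pluck ((i , j) ∷ ps) i j ps
  first′ : ∀ {i j ps} → Pluck ((j , i) ∷ ps) i j ps
  later  : ∀ {i j p ps qs} → Pluck ps i j qs → Pluck (p ∷ ps) i j (p ∷ qs)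

pluck : ∀ ps i → Maybe (∃₂ λ j qs → Pluck ps i j qs)
pluck [] i = nothing
pluck ((u , v) ∷ ps) i with u ≟ i | v ≟ i
... | yes refl | _        = just (v , ps , first)
... | no _     | yes refl = just (u , ps , first′)
... | no _     | no _     = case pluck ps i of λ
  { (just (j , qs , p)) → just (j , _ , later p)
  ; nothing → nothing }

pluck-ends : ∀ {ps i j qs} → Pluck ps i j qs → j ∈ ends ps × ends qs ⊆ ends ps
pluck-ends first     = there (here refl) , λ q → there (there q)
pluck-ends first′    = here refl , λ q → there (there q)
pluck-ends (later p) = there (there (proj₁ (pluck-ends p))) , λ
  { (here e) → here e
  ; (there (here e)) → there (here e)
  ; (there (there q)) → there (there (proj₂ (pluck-ends p) q)) }

Family-∷ : ∀ {b σ e ps vs n} → Family b σ ps vs n → Family (e ∷ b) σ ps vs n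
Family-∷ [] = []
Family-∷ (p ∷ f) = BluePath-∷ p ∷ Family-∷ f

record Plucked (b : Board) (σ : ℕ → ℕ) (i j : ℕ) (qs : Pairs) (vs : List ℕ) (n : ℕ) : Set where
  constructor plucked
  field
    {inside outside} : List ℕ
    {k m} : ℕ
    path  : BluePath b (σ i) (σ j) inside k
    rest  : Family b σ qs outside m
    perm  : vs ↭ inside ++ outside
    sum   : n ≡ k + m

Family-pluck : ∀ {b σ ps i j qs vs n} → Pluck ps i j qs → Family b σ ps vs n → Plucked b σ i j qs vs n
Family-pluck first (p ∷ f) = plucked p f ↭-refl refl
Family-pluck first′ (_∷_ {ws = ws} p f) with reversed p
... | _ , perm , q = plucked q f (++⁺ʳ ws (↭-sym perm)) refl
Family-pluck (later pl) (_∷_ {vs = vs} {k = k} p f) with Family-pluck pl f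
... | plucked {inside} {outside} {k′} {m} q f′ perm e = plucked q (p ∷ f′)
  (↭-trans (++⁺ˡ vs perm) (shifts vs inside))
  (trans (cong (k +_) e) (trans (sym (+-assoc k k′ m)) (trans (cong (_+ m) (+-comm k k′)) (+-assoc k′ k m))))

singles-length : ∀ {b σ ps vs n} → All (λ (i , j) → i ≡ j) ps → Family b σ ps vs n → Unique vs → n ≡ 0
singles-length [] [] _ = refl
singles-length (refl ∷ s) (_∷_ {vs = vs} p f) u =
  cong₂ _+_ (closed-path p (Unique-++ˡ vs u)) (singles-length s f (Unique-++ʳ vs u))

-- Playing a move

grow : Pattern → Pattern
grow (mkPattern s ps rs ts) = mkPattern (2 + s) ((s , s) ∷ (suc s , suc s) ∷ ps) rs ts

grow-realises : ∀ {b σ P n} → Realises b σ P n → Realises b σ (grow P) n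
grow-realises {b} {σ} {P} r = record
  { injective = injective
  ; vertices  = σ s ∷ σ (suc s) ∷ vertices
  ; family    = [-] ∷ [-] ∷ family
  ; unique    = ((λ e → 1+n≢n (sym (injective e))) ∷ ¬Any⇒All¬ vertices (unused ≤-refl))
                ∷ ¬Any⇒All¬ vertices (unused (n≤1+n s)) ∷ unique
  ; redEdges  = redEdges
  ; unused    = λ { le (here e) → 1+n≰n (≤-trans (n≤1+n _) (≤-trans le (≤-reflexive (injective e))))
                  ; le (there (here e)) → 1+n≰n (≤-trans le (≤-reflexive (injective e)))
                  ; le (there (there i)) → unused (weaken le) i }
  ; fresh     = fresh ∘ weaken
  ; apart     = apart′
  }
  where
  open Realises r
  s = size P
  weaken : ∀ {i} → 2 + s ≤ i → s ≤ i
  weaken = ≤-trans (m≤n+m s 2)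
  split : ∀ {i} → i ∈ ends (paths (grow P)) → s ≤ i ⊎ i ∈ ends (paths P)
  split (here refl) = inj₁ ≤-refl
  split (there (here refl)) = inj₁ ≤-refl
  split (there (there (here refl))) = inj₁ (n≤1+n s)
  split (there (there (there (here refl)))) = inj₁ (n≤1+n s)
  split (there (there (there (there i)))) = inj₂ i
  apart′ : ∀ {i j} → i ∈ ends (paths (grow P)) → j ∈ ends (paths (grow P)) →
    Adjacent b (σ i) (σ j) → Joined (ties P) i j
  apart′ i∈ j∈ a with split i∈ | split j∈
  ... | inj₁ le | _ = contradiction a (fresh le _)
  ... | inj₂ _ | inj₁ le = contradiction (proj₁ a , swap (proj₂ a)) (fresh le _)
  ... | inj₂ p | inj₂ q = apart p q a

afterRed : Pattern → ℕ → ℕ → Pattern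
afterRed (mkPattern s ps rs ts) i j = mkPattern s ps ((i , j) ∷ rs) ((i , j) ∷ ts)

afterBlue : Pattern → ℕ → ℕ → ℕ → ℕ → Pairs → Pattern
afterBlue (mkPattern s ps rs ts) i j i′ j′ qs = mkPattern s ((i′ , j′) ∷ qs) rs ((i , j) ∷ ts)

module _ {b σ P n} (r : Realises b σ P n) {i j : ℕ} (i<s : i < size P) (j<s : j < size P) where
  open Realises r

  fresh-∷ : ∀ {c k} → size P ≤ k → ∀ y → ¬ Adjacent (edge (σ i) (σ j) c ∷ b) (σ k) y
  fresh-∷ le y a with Adjacent-∷⁻ a
  ... | inj₁ a′ = fresh le y a′
  ... | inj₂ (inj₁ (e , _)) = <⇒≱ i<s (≤-trans le (≤-reflexive (injective e)))
  ... | inj₂ (inj₂ (e , _)) = <⇒≱ j<s (≤-trans le (≤-reflexive (injective e)))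

  apart-∷ : ∀ {c k l} → k ∈ ends (paths P) → l ∈ ends (paths P) → Adjacent (edge (σ i) (σ j) c ∷ b) (σ k) (σ l) →
    Joined ((i , j) ∷ ties P) k l
  apart-∷ p q a with Adjacent-∷⁻ a
  ... | inj₁ a′ = Sum.map there there (apart p q a′)
  ... | inj₂ (inj₁ (e , f)) = inj₁ (here (cong₂ _,_ (injective e) (injective f)))
  ... | inj₂ (inj₂ (e , f)) = inj₂ (here (cong₂ _,_ (injective f) (injective e)))

  play-red : Realises (edge (σ i) (σ j) red ∷ b) σ (afterRed P i j) n
  play-red = record
    { injective = injective
    ; vertices  = vertices
    ; family    = Family-∷ family
    ; unique    = unique
    ; redEdges  = inj₁ (here refl) ∷ All.map HasEdge-∷ redEdges
    ; unused    = unused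
    ; fresh     = fresh-∷
    ; apart     = apart-∷
    }

  -- The path at `i` is turned round and continued through the new edge into the path at `j`, which
  -- leaves the far ends `i′` and `j′`. Plucking `j` from what remains without the path at `i`
  -- excludes closing a cycle.
  play-blue : ∀ {i′ j′ qs qs′} → Pluck (paths P) i i′ qs → Pluck qs j j′ qs′ →
    Realises (edge (σ i) (σ j) blue ∷ b) σ (afterBlue P i j i′ j′ qs′) (suc n)
  play-blue {i′} {j′} {qs} {qs′} p q with Family-pluck p (Family-∷ {e = edge (σ i) (σ j) blue} family)
  ... | plucked {inside = V} {k = k} path f perm refl with Family-pluck q f
  ... | plucked {inside = W} {outside = Z} {k = l} path′ f′ perm′ refl with reversed path
  ... | V′ , revPerm , back = record
    { injective = injective
    ; vertices  = (V′ ++ W) ++ Z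
    ; family    = subst (Family _ σ _ _) (cong suc (+-assoc k l _)) (join back (inj₁ (here refl)) path′ ∷ f′)
    ; unique    = Unique-resp-↭ whole unique
    ; redEdges  = All.map HasEdge-∷ redEdges
    ; unused    = λ le v → unused le (∈-resp-↭ (↭-sym whole) v)
    ; fresh     = fresh-∷
    ; apart     = λ u v → apart-∷ (old u) (old v)
    }
    where
    whole : vertices ↭ (V′ ++ W) ++ Z
    whole = ↭-trans perm (↭-trans (++⁺ (↭-sym revPerm) perm′)
      (subst (V′ ++ W ++ Z ↭_) (sym (++-assoc V′ W Z)) ↭-refl))
    old : ∀ {k} → k ∈ ends ((i′ , j′) ∷ qs′) → k ∈ ends (paths P)
    old (here refl) = proj₁ (pluck-ends p)
    old (there (here refl)) = proj₂ (pluck-ends p) (proj₁ (pluck-ends q))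
    old (there (there k∈)) = proj₂ (pluck-ends p) (proj₂ (pluck-ends q) k∈)

-- Relabelling

-- Beyond the list `π` the new label `a` means `s + a`, since both recursive arguments shift
-- together. With the old size for `s` these are untouched labels, so the map is injective on all
-- labels whenever `π` consists of distinct labels below `s`.
relabel : List ℕ → ℕ → ℕ → ℕ
relabel []      s a       = s + a
relabel (x ∷ π) s zero    = x
relabel (x ∷ π) s (suc a) = relabel π (suc s) a

relabel-fresh : ∀ π s {a} → length π ≤ a → s ≤ relabel π s a
relabel-fresh [] s _ = m≤m+n s _
relabel-fresh (x ∷ π) s {suc a} (s≤s le) = ≤-trans (n≤1+n s) (relabel-fresh π (suc s) le)

relabel-range : ∀ π s a → relabel π s a ∈ π ⊎ s ≤ relabel π s a
relabel-range [] s a = inj₂ (m≤m+n s a)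
relabel-range (x ∷ π) s zero = inj₁ (here refl)
relabel-range (x ∷ π) s (suc a) = Sum.map there (≤-trans (n≤1+n s)) (relabel-range π (suc s) a)

relabel-∉ : ∀ {x} π s {a} → All (x ≢_) π → x < s → x ≢ relabel π s a
relabel-∉ π s {a} x∉ x<s e with relabel-range π s a
... | inj₁ i  = All.lookup x∉ i e
... | inj₂ le = <⇒≱ x<s (≤-trans le (≤-reflexive (sym e)))

relabel-injective : ∀ π s → Unique π → All (_< s) π → ∀ {a a′} → relabel π s a ≡ relabel π s a′ → a ≡ a′
relabel-injective [] s _ _ e = +-cancelˡ-≡ s _ _ e
relabel-injective (x ∷ π) s _ _ {zero} {zero} _ = refl
relabel-injective (x ∷ π) s (x∉ ∷ _) (x<s ∷ _) {zero} {suc a} e =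
  contradiction e (relabel-∉ π (suc s) x∉ (m<n⇒m<1+n x<s))
relabel-injective (x ∷ π) s (x∉ ∷ _) (x<s ∷ _) {suc a} {zero} e =
  contradiction (sym e) (relabel-∉ π (suc s) x∉ (m<n⇒m<1+n x<s))
relabel-injective (x ∷ π) s (_ ∷ u) (_ ∷ l) {suc a} {suc a′} e =
  cong suc (relabel-injective π (suc s) u (All.map m<n⇒m<1+n l) e)

-- Paths may be dropped only if their two ends coincide. Such paths have no edges, so the total
-- number of blue edges is unchanged.
data Covers (ρ : ℕ → ℕ) : Pairs → Pairs → Set where
  done : ∀ {ps} → All (λ (i , j) → i ≡ j) ps → Covers ρ ps []
  take : ∀ {ps qs a a′ rs} → Pluck ps (ρ a) (ρ a′) qs → Covers ρ qs rs → Covers ρ ps ((a , a′) ∷ rs)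

covers? : ∀ ρ ps qs → Maybe (Covers ρ ps qs)
covers? ρ ps [] = case all? (λ (i , j) → i ≟ j) ps of λ { (yes a) → just (done a) ; (no _) → nothing }
covers? ρ ps ((a , a′) ∷ qs) with pluck ps (ρ a)
... | nothing = nothing
... | just (j , rs , p) with j ≟ ρ a′
... | no _ = nothing
... | yes refl = case covers? ρ rs qs of λ { (just c) → just (take p c) ; nothing → nothing }

Family-cover : ∀ {b σ ρ ps qs vs n} → Covers ρ ps qs → Family b σ ps vs n → Unique vs →
  ∃ λ ws → Family b (σ ∘ ρ) qs ws n × Unique ws × ws ⊆ vs
Family-cover (done s) f u = [] , subst (Family _ _ _ _) (sym (singles-length s f u)) [] , [] , λ ()
Family-cover {vs = vs} (take p c) f u with Family-pluck p f
... | plucked {inside = V} path f′ perm refl with Family-cover c f′ (Unique-++ʳ V (Unique-resp-↭ perm u))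
... | ws , g , v , ws⊆ = V ++ ws , path ∷ g , Unique-++-⊆ V (Unique-resp-↭ perm u) v ws⊆ ,
  λ i → ∈-resp-↭ (↭-sym perm) ([ ∈-++⁺ˡ , ∈-++⁺ʳ V ∘ ws⊆ ]′ (∈-++⁻ V i))

module _ (P : Pattern) (π : List ℕ) (Q : Pattern) where
  private ρ = relabel π (size P)

  -- `Q` is a weaker description of the same board: red edges may be forgotten, and further
  -- adjacencies may be allowed for, but none that `P` allows between kept ends may be lost.
  record Embeds : Set where
    constructor embeds
    field
      fits   : length π ≤ size Q
      unique : Unique π
      below  : All (_< size P) π
      covers : Covers ρ (paths P) (paths Q)
      keepsRed  : All (λ (a , a′) → Joined (reds P) (ρ a) (ρ a′)) (reds Q)
      keepsEnds : All (λ a → ρ a ∈ ends (paths P)) (ends (paths Q))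
      keepsTies : All (λ a → All (λ a′ → Joined (ties P) (ρ a) (ρ a′) → Joined (ties Q) a a′)
                                 (ends (paths Q))) (ends (paths Q))

  -- Here and in the later checks a refutation would serve no purpose: the table is fixed, and only
  -- evidence of success is extracted.
  embeds? : Maybe Embeds
  embeds? = do
    fits   ← dec⇒maybe (length π ≤? size Q)
    unique ← dec⇒maybe (unique? π)
    below  ← dec⇒maybe (all? (_<? size P) π)
    covers ← covers? ρ (paths P) (paths Q)
    keepsRed  ← dec⇒maybe (all? (λ (a , a′) → joined? (reds P) (ρ a) (ρ a′)) (reds Q))
    keepsEnds ← dec⇒maybe (all? (λ a → ρ a ∈? ends (paths P)) (ends (paths Q)))
    keepsTies ← dec⇒maybe (all? (λ a → all? (λ a′ → joined? (ties P) (ρ a) (ρ a′) →-dec joined? (ties Q) a a′)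
                                            (ends (paths Q))) (ends (paths Q)))
    just (embeds fits unique below covers keepsRed keepsEnds keepsTies)

  embed : ∀ {b σ n} → Embeds → Realises b σ P n → Realises b (σ ∘ ρ) Q n
  embed {b} {σ} e r with Family-cover (Embeds.covers e) (Realises.family r) (Realises.unique r)
  ... | ws , f , u , ws⊆ = record
    { injective = λ q → relabel-injective π (size P) unique below (R.injective q)
    ; vertices  = ws
    ; family    = f
    ; unique    = u
    ; redEdges  = All.map (Joined-red {b} σ R.redEdges) keepsRed
    ; unused    = λ le v → R.unused (outside le) (ws⊆ v)
    ; fresh     = λ le → R.fresh (outside le)
    ; apart     = λ i j a → All.lookup (All.lookup keepsTies i) j
                    (R.apart (All.lookup keepsEnds i) (All.lookup keepsEnds j) a)
    }
    where
    module R = Realises r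
    open Embeds e
    outside : ∀ {a} → size Q ≤ a → size P ≤ ρ a
    outside le = relabel-fresh π (size P) (≤-trans fits le)

-- Builder's strategy

-- The new pattern has number t, and its label a is the label π[a] of the old one.  The labels
-- size and 1 + size of the old pattern are the fresh vertices available for the move.
data Reply : Set where
  win  : (a b c d : ℕ) → Reply
  goto : (t : ℕ) (π : List ℕ) → Reply

record Rule : Set where
  constructor draw
  field
    i j    : ℕ
    onBlue : ℕ
    π      : List ℕ
    onRed  : Reply

-- Let m blue edges be missing.  For usual = just (m₀ , c) and m ≥ m₀ the first rule wins in
-- (7 * m + c) / 5 ∸ 2 rounds; a special (m , n , k) allots n ∸ 2 rounds and uses rule k instead.
-- Adding 2 to all budgets keeps c nonnegative.
record Entry : Set where
  field
    pat      : Pattern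
    usual    : Maybe (ℕ × ℕ)
    specials : List (ℕ × ℕ × ℕ)
    rules    : List Rule
open Entry

-- A path with two different ends may be a single edge, so its ends count as tied. Listing too many
-- ties is safe, as a tie only forbids a move.
entry : ℕ → Pairs → Pairs → Maybe (ℕ × ℕ) → List (ℕ × ℕ × ℕ) → List Rule → Entry
entry s ps rs u ss Rs = record
  { pat      = mkPattern s ps rs (filter (λ (i , j) → ¬? (i ≟ j)) ps ++ rs)
  ; usual    = u
  ; specials = ss
  ; rules    = Rs
  }

nth : {A : Set} → List A → ℕ → Maybe A
nth []       _       = nothing
nth (x ∷ xs) zero    = just x
nth (x ∷ xs) (suc k) = nth xs k

nth-∈ : {A : Set} (xs : List A) (k : ℕ) {x : A} → nth xs k ≡ just x → x ∈ xs
nth-∈ (x ∷ xs) zero    refl = here refl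
nth-∈ (x ∷ xs) (suc k) e    = there (nth-∈ xs k e)

-- Every `m` up to and including `horizon` is checked separately. The special budgets already cease
-- at `horizon` itself, so that from any larger `m` a blue answer leads to a value where the linear
-- budget applies.
horizon : ℕ
horizon = 8

planUsual : Maybe (ℕ × ℕ) → ℕ → Maybe (ℕ × ℕ)
planUsual nothing         m = nothing
planUsual (just (m₀ , c)) m = if does (m₀ ≤? m) then just ((7 * m + c) / 5 , 0) else nothing

planSpecial : List (ℕ × ℕ × ℕ) → Maybe (ℕ × ℕ) → ℕ → Maybe (ℕ × ℕ)
planSpecial []                  u m = planUsual u m
planSpecial ((m′ , n , k) ∷ ss) u m = if does (m′ ≟ m) then just (n , k) else planSpecial ss u m

plan : Entry → ℕ → Maybe (ℕ × ℕ)
plan E m = if does (m <? horizon) then planSpecial (specials E) (usual E) m else planUsual (usual E) m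

planUsual-≤ : ∀ {m₀ m} c → m₀ ≤ m → planUsual (just (m₀ , c)) m ≡ just ((7 * m + c) / 5 , 0)
planUsual-≤ {m₀} {m} c le rewrite dec-true (m₀ ≤? m) le = refl

plan-far : ∀ E {m} → horizon ≤ m → plan E m ≡ planUsual (usual E) m
plan-far E {m} le rewrite dec-false (m <? horizon) (≤⇒≯ le) = refl

allMaybe : ∀ {A : Set} {Q : A → Set} → (∀ x → Maybe (Q x)) → ∀ xs → Maybe (All Q xs)
allMaybe q? [] = just []
allMaybe q? (x ∷ xs) = do
  q ← q? x
  qs ← allMaybe q? xs
  just (q ∷ qs)

[5+x]/5≡1+x/5 : ∀ x → (5 + x) / 5 ≡ suc (x / 5)
[5+x]/5≡1+x/5 x = m/n≡1+[m∸n]/n {5 + x} {5} (m≤m+n 5 x)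

-- Soundness of the moves in a table

module Table (table : List Entry) where

  -- A number outside the table yields an entry without any budget, for which all claims about plans
  -- hold vacuously.
  at′ : List Entry → ℕ → Entry
  at′ []       _       = entry 0 [] [] nothing [] []
  at′ (E ∷ Es) zero    = E
  at′ (E ∷ Es) (suc t) = at′ Es t

  at : ℕ → Entry
  at = at′ table

  pattern-at : ℕ → Pattern
  pattern-at t = pat (at t)

  at-all : ∀ {Q : Entry → Set} → Q (entry 0 [] [] nothing [] []) → All Q table → ∀ t → Q (at t)
  at-all {Q} z = go table
    where
    go : ∀ Es → All Q Es → ∀ t → Q (at′ Es t)
    go [] _ t = z
    go (E ∷ Es) (q ∷ qs) zero = q
    go (E ∷ Es) (q ∷ qs) (suc t) = go Es qs t

  module _ (P : Pattern) (i j : ℕ) where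

    Legal : Set
    Legal = (i < size P × j < size P) × (i ∈ ends (paths P) × j ∈ ends (paths P)) × (i ≢ j × ¬ Joined (ties P) i j)

    legal? : Dec Legal
    legal? = ((i <? size P) ×-dec (j <? size P)) ×-dec ((i ∈? ends (paths P)) ×-dec (j ∈? ends (paths P)))
             ×-dec (¬? (i ≟ j) ×-dec ¬? (joined? (ties P) i j))

    data BlueSound (t : ℕ) (π : List ℕ) : Set where
      merges : ∀ {i′ j′ qs qs′} → Pluck (paths P) i i′ qs → Pluck qs j j′ qs′ →
        Embeds (afterBlue P i j i′ j′ qs′) π (pattern-at t) → BlueSound t π

    blueSound? : ∀ t π → Maybe (BlueSound t π)
    blueSound? t π = do
      (_ , qs , p) ← pluck (paths P) i
      (_ , _ , q) ← pluck qs j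
      e ← embeds? _ π (pattern-at t)
      just (merges p q e)

    RedSound : Reply → Set
    RedSound (win a b c d) = Unique (a ∷ b ∷ c ∷ d ∷ []) ×
      Joined ((i , j) ∷ reds P) a b × Joined ((i , j) ∷ reds P) b c × Joined ((i , j) ∷ reds P) c d
    RedSound (goto t π) = Embeds (afterRed P i j) π (pattern-at t)

    redSound? : ∀ r → Maybe (RedSound r)
    redSound? (win a b c d) = dec⇒maybe (unique? (a ∷ b ∷ c ∷ d ∷ []) ×-dec
      joined? ((i , j) ∷ reds P) a b ×-dec joined? ((i , j) ∷ reds P) b c ×-dec joined? ((i , j) ∷ reds P) c d)
    redSound? (goto t π) = embeds? (afterRed P i j) π (pattern-at t)

  record Sound (P : Pattern) (R : Rule) : Set where
    constructor sound
    open Rule R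
    field
      legal     : Legal P i j
      blueSound : BlueSound P i j onBlue π
      redSound  : RedSound P i j onRed

  sound? : ∀ P R → Maybe (Sound P R)
  sound? P (draw i j t π r) = do
    l ← dec⇒maybe (legal? P i j)
    s ← blueSound? P i j t π
    s′ ← redSound? P i j r
    just (sound l s s′)

  EntrySound : Entry → Set
  EntrySound E = All (Sound (grow (pat E))) (rules E)

  entrySound? : ∀ E → Maybe (EntrySound E)
  entrySound? E = allMaybe (sound? (grow (pat E))) (rules E)

  -- Budgets of rounds

  Within : ℕ → ℕ → ℕ → Set
  Within t m n = ∃₂ λ n′ k → plan (at t) m ≡ just (n′ , k) × n′ ≤ n

  within? : ∀ t m n → Maybe (Within t m n)
  within? t m n with plan (at t) m
  ... | nothing = nothing
  ... | just (n′ , k) = do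
    le ← dec⇒maybe (n′ ≤? n)
    just (n′ , k , refl , le)

  ReplyWithin : Reply → ℕ → ℕ → Set
  ReplyWithin (win _ _ _ _) m n = ⊤
  ReplyWithin (goto t _)    m n = Within t m n

  replyWithin? : ∀ r m n → Maybe (ReplyWithin r m n)
  replyWithin? (win _ _ _ _) m n = just tt
  replyWithin? (goto t _)    m n = within? t m n

  Finished : Pairs → Set
  Finished []       = ⊥
  Finished (_ ∷ ps) = All (λ (i , j) → i ≡ j) ps

  finished? : ∀ ps → Dec (Finished ps)
  finished? []       = no λ ()
  finished? (_ ∷ ps) = all? (λ (i , j) → i ≟ j) ps

  -- Budgets exceed the number of rounds by 2, so 3 ≤ n says that at least one round is left.
  Progress : Entry → ℕ → ℕ → ℕ → Set
  Progress E m n k = (m ≡ 0 × Finished (paths (pat E))) ⊎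
    (3 ≤ n × ∃ λ R → R ∈ rules E × Within (Rule.onBlue R) (m ∸ 1) (n ∸ 1) × ReplyWithin (Rule.onRed R) m (n ∸ 1))

  Progressive : Entry → ℕ → Set
  Progressive E m = ∀ {n k} → plan E m ≡ just (n , k) → Progress E m n k

  progress? : ∀ E m n k → Maybe (Progress E m n k)
  progress? E m n k with (m ≟ 0) ×-dec finished? (paths (pat E))
  ... | yes f = just (inj₁ f)
  ... | no _ with nth (rules E) k in eq
  ... | nothing = nothing
  ... | just R = do
    le ← dec⇒maybe (3 ≤? n)
    b ← within? (Rule.onBlue R) (m ∸ 1) (n ∸ 1)
    r ← replyWithin? (Rule.onRed R) m (n ∸ 1)
    just (inj₂ (le , R , nth-∈ (rules E) k eq , b , r))

  progressive? : ∀ E m → Maybe (Progressive E m)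
  progressive? E m with plan E m
  ... | nothing = just λ ()
  ... | just (n , k) = do
    p ← progress? E m n k
    just λ { refl → p }

  -- With `m₀` at most `horizon`, the linear budget is in force for all `m` from `horizon` on.
  Slope : ℕ → ℕ → Set
  Slope t c = ∃₂ λ m₀ c′ → usual (at t) ≡ just (m₀ , c′) × m₀ ≤ horizon × c′ ≤ c

  slope? : ∀ t c → Maybe (Slope t c)
  slope? t c with usual (at t)
  ... | nothing = nothing
  ... | just (m₀ , c′) = do
    le ← dec⇒maybe (m₀ ≤? horizon)
    le′ ← dec⇒maybe (c′ ≤? c)
    just (m₀ , c′ , refl , le , le′)

  ReplySlope : Reply → ℕ → Set
  ReplySlope (win _ _ _ _) c = ⊤
  ReplySlope (goto t _)    c = 5 ≤ c × Slope t (c ∸ 5)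

  replySlope? : ∀ r c → Maybe (ReplySlope r c)
  replySlope? (win _ _ _ _) c = just tt
  replySlope? (goto t _)    c = do
    le ← dec⇒maybe (5 ≤? c)
    s ← slope? t (c ∸ 5)
    just (le , s)

  -- Both 7(m - 1) + (c + 2) and 7m + (c - 5) equal 7m + c - 5, which after division by 5 is one
  -- round less. A single check of constants thus covers all large `m`.
  Steady : Entry → Set
  Steady E = ∀ {m₀ c} → usual E ≡ just (m₀ , c) →
    ∃ λ R → R ∈ rules E × Slope (Rule.onBlue R) (2 + c) × ReplySlope (Rule.onRed R) c

  steady? : ∀ E → Maybe (Steady E)
  steady? E with usual E | rules E
  ... | nothing       | _     = just λ ()
  ... | just _        | []    = nothing
  ... | just (m₀ , c) | R ∷ _ = do
    s ← slope? (Rule.onBlue R) (2 + c)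
    s′ ← replySlope? (Rule.onRed R) c
    just λ { refl → R , here refl , s , s′ }

  BudgetSound : Entry → Set
  BudgetSound E = Steady E × All (Progressive E) (upTo (suc horizon))

  budgetSound? : ∀ E → Maybe (BudgetSound E)
  budgetSound? E = do
    s ← steady? E
    p ← allMaybe (progressive? E) (upTo (suc horizon))
    just (s , p)

  slope⇒within : ∀ {t c x} m → horizon ≤ m → Slope t c → 5 + (7 * m + c) ≤ x → Within t m (x / 5 ∸ 1)
  slope⇒within {t} {c} {x} m le (m₀ , c′ , eq , m₀≤ , c′≤c) bound =
    _ , 0 ,
    trans (plan-far (at t) le) (trans (cong (λ u → planUsual u m) eq) (planUsual-≤ c′ (≤-trans m₀≤ le))) ,
    ≤-pred (begin
      suc ((7 * m + c′) / 5)  ≡⟨ sym ([5+x]/5≡1+x/5 (7 * m + c′)) ⟩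
      (5 + (7 * m + c′)) / 5  ≤⟨ /-monoˡ-≤ 5 (≤-trans (+-monoʳ-≤ 5 (+-monoʳ-≤ (7 * m) c′≤c)) bound) ⟩
      x / 5                   ≡⟨ sym (m+[n∸m]≡n {1} (m≥n⇒m/n>0 (≤-trans (m≤m+n 5 _) bound))) ⟩
      suc (x / 5 ∸ 1)         ∎)
    where
    open ≤-Reasoning

  planUsual⁻ : ∀ {u m n k} → planUsual u m ≡ just (n , k) → ∃₂ λ m₀ c → u ≡ just (m₀ , c) × n ≡ (7 * m + c) / 5
  planUsual⁻ {just (m₀ , c)} {m} e with does (m₀ ≤? m)
  planUsual⁻ {just (m₀ , c)} {m} refl | true = m₀ , c , refl , refl
  planUsual⁻ {just (m₀ , c)} {m} () | false

  far-progressive : ∀ E m → horizon < m → Steady E → Progressive E m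
  far-progressive E (suc m) (s≤s le) steady e
    with planUsual⁻ {usual E} (trans (sym (plan-far E (m≤n⇒m≤1+n le))) e)
  ... | m₀ , c , eq , refl with steady eq
  ... | R , R∈ , s , s′ = inj₂ (/-monoˡ-≤ {15} 5 (≤-trans big (m≤m+n _ c)) , R , R∈ ,
    slope⇒within m le s (≤-reflexive (shift m c)) , red-reply (Rule.onRed R) s′)
    where
    -- A budget of at least 3 requires a numerator of at least 15. Beyond the horizon at least 9
    -- edges are missing, which gives 63.
    big : 15 ≤ 7 * suc m
    big = ≤-trans (≤ᵇ⇒≤ 15 63 tt) (*-monoʳ-≤ 7 (s≤s le))
    shift : ∀ m c → 5 + (7 * m + (2 + c)) ≡ 7 * (1 + m) + c
    shift = solve-∀
    red-reply : ∀ r → ReplySlope r c → ReplyWithin r (suc m) ((7 * suc m + c) / 5 ∸ 1)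
    red-reply (win _ _ _ _) _ = tt
    red-reply (goto t _) (5≤c , s) = slope⇒within (suc m) (m≤n⇒m≤1+n le) s
      (≤-reflexive (trans (exchange (7 * suc m) (c ∸ 5)) (cong (7 * suc m +_) (m+[n∸m]≡n 5≤c))))
      where
      exchange : ∀ x y → 5 + (x + y) ≡ x + (5 + y)
      exchange = solve-∀

  -- From a checked table to a winning strategy

  module _ (sounds : All EntrySound table) (budgets : All BudgetSound table) where

    entrySound : ∀ t → EntrySound (at t)
    entrySound = at-all {EntrySound} [] sounds

    progressive : ∀ t m → Progressive (at t) m
    progressive t m with m ≤? horizon
    ... | yes le = at-all {λ E → Progressive E m} blank
      (All.map (λ q → All.lookup (proj₂ q) (∈-upTo⁺ (s≤s le))) budgets) t
      where
      blank : Progressive (entry 0 [] [] nothing [] []) m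
      blank e with does (m <? horizon)
      blank () | true
      blank () | false
    ... | no ¬le = far-progressive (at t) m (≰⇒> ¬le) (at-all {Steady} (λ ()) (All.map proj₁ budgets) t)

    module _ (ℓ : ℕ) where

      Wins : ℕ → Board → Set
      Wins = BuilderWinsWithin (Path 4) (Path (suc ℓ))

      won : ∀ r {b} → BuilderHasWon (Path 4) (Path (suc ℓ)) b → Wins r b
      won zero    w = w
      won (suc r) w = inj₁ w

      -- The other paths are single vertices, so all `n` blue edges lie on the first path.
      finished-won : ∀ {b σ P n} → Finished (paths P) → Realises b σ P n → ℓ ≤ n →
        BuilderHasWon (Path 4) (Path (suc ℓ)) b
      finished-won {P = mkPattern _ (_ ∷ ps) _ _} singles r ℓ≤n with Realises.family r | Realises.unique r
      ... | _∷_ {vs = vs} {k = k} p f | u = inj₂ (BluePath⇒Path ℓ p (Unique-++ˡ vs u)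
        (≤-trans ℓ≤n (≤-reflexive (trans (cong (k +_) (singles-length singles f (Unique-++ʳ vs u))) (+-identityʳ k)))))

      red-won : ∀ {b σ es a₀ a₁ a₂ a₃} → (∀ {i j} → σ i ≡ σ j → i ≡ j) → RedEdges b σ es →
        Unique (a₀ ∷ a₁ ∷ a₂ ∷ a₃ ∷ []) →
        Joined es a₀ a₁ → Joined es a₁ a₂ → Joined es a₂ a₃ → ContainsMono b red (Path 4)
      red-won {b} {σ} {es} {a₀} {a₁} {a₂} {a₃} inj reds u j₀ j₁ j₂ =
        σ ∘ lookup as , (λ e → lookup-injective u _ _ (inj e)) ,
        λ { i j (inj₁ q) → forward i j q ; i j (inj₂ q) → swap (forward j i q) }
        where
        as = a₀ ∷ a₁ ∷ a₂ ∷ a₃ ∷ []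
        forward : ∀ (i j : Fin 4) → suc (toℕ i) ≡ toℕ j → HasEdge b red (σ (lookup as i)) (σ (lookup as j))
        forward zero (suc zero) _ = Joined-red {b} σ reds j₀
        forward (suc zero) (suc (suc zero)) _ = Joined-red {b} σ reds j₁
        forward (suc (suc zero)) (suc (suc (suc zero))) _ = Joined-red {b} σ reds j₂
        forward (suc (suc (suc zero))) (suc (suc (suc zero))) ()
        forward (suc (suc (suc zero))) (suc (suc zero)) ()
        forward (suc (suc (suc zero))) (suc zero) ()
        forward (suc (suc zero)) (suc (suc zero)) ()
        forward (suc (suc zero)) (suc zero) ()
        forward (suc zero) (suc zero) ()
        forward (suc zero) (suc (suc (suc zero))) ()
        forward zero (suc (suc zero)) ()
        forward zero (suc (suc (suc zero))) ()

      -- Induction on the rounds left. The family has `n` blue edges and `m` more suffice; a blue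
      -- answer shifts one from `m` to `n`, while a red one changes neither and is paid for by a
      -- cheaper pattern or ends the game.
      wins : ∀ r t m {b σ n} → Within t m (2 + r) → Realises b σ (pattern-at t) n → ℓ ≤ n + m → Wins r b
      wins r t m {b} {σ} {n} (budget , k , eq , le) real ℓ≤ with progressive t m eq
      ... | inj₁ (refl , fin) = won r (finished-won fin real (≤-trans ℓ≤ (≤-reflexive (+-identityʳ n))))
      -- Without rounds the budget is at most 2, whereas an unfinished position has at least 3.
      wins zero t m (budget , k , eq , le) real ℓ≤ | inj₂ (3≤ , _) =
        contradiction (≤-trans 3≤ le) λ { (s≤s (s≤s ())) }
      wins (suc r) t m {b} {σ} {n} (budget , k , eq , le) real ℓ≤ | inj₂ (3≤ , R , R∈ , onB , onR) =
        move (All.lookup (entrySound t) R∈)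
        where
        open Rule R
        P = grow (pattern-at t)
        grown : Realises b σ P n
        grown = grow-realises real
        relax : ∀ {t m} → Within t m (budget ∸ 1) → Within t m (2 + r)
        relax (n′ , k′ , e , le′) = n′ , k′ , e , ≤-trans le′ (∸-monoˡ-≤ 1 le)
        longer : ℓ ≤ suc n + (m ∸ 1)
        longer = ≤-trans ℓ≤ (≤-trans (+-monoʳ-≤ n (m≤n+m∸n m 1)) (≤-reflexive (+-suc n (m ∸ 1))))
        move : Sound P R → Wins (suc r) b
        move (sound ((i<s , j<s) , (i∈ , j∈) , (i≢j , untied)) (merges p q emb) redSound) = inj₂
          ( σ i , σ j , (λ e → i≢j (Realises.injective grown e)) , (λ a → untied (Realises.apart grown i∈ j∈ a)) , λ
          { blue → wins r onBlue (m ∸ 1) (relax onB)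
              (embed _ π (pattern-at onBlue) emb (play-blue grown i<s j<s p q)) longer
          ; red  → reply onRed redSound onR } )
          where
          reply : ∀ o → RedSound P i j o → ReplyWithin o m (budget ∸ 1) → Wins r (edge (σ i) (σ j) red ∷ b)
          reply (win a₀ a₁ a₂ a₃) (u , j₀ , j₁ , j₂) _ = won r (inj₁
            (red-won (Realises.injective grown) (Realises.redEdges (play-red grown i<s j<s)) u j₀ j₁ j₂))
          reply (goto t′ π′) emb′ w = wins r t′ m (relax w)
            (embed _ π′ (pattern-at t′) emb′ (play-red grown i<s j<s)) ℓ≤

-- Found by computer search.
strategy : List Entry
strategy =
  -- The empty board. The constant 16 is 6 + 10: the 6 comes from the ceiling of (7ℓ + 2)/5, the 10
  -- from the offset of two rounds.
  entry 0 [] [] (just (3 , 16)) []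
    (draw 0 1 2 (0 ∷ 1 ∷ []) (goto 4 (0 ∷ 1 ∷ [])) ∷ []) ∷
  entry 3 ((0 , 1) ∷ []) ((0 , 1) ∷ (0 , 2) ∷ []) (just (0 , 12)) ((1 , 3 , 1) ∷ (3 , 7 , 0) ∷ [])
    (draw 3 4 20 (0 ∷ 3 ∷ 4 ∷ 1 ∷ 2 ∷ []) (goto 21 (0 ∷ 3 ∷ 4 ∷ 1 ∷ 2 ∷ [])) ∷ draw 1 3 3 (3 ∷ 0 ∷ 1 ∷ []) (win 2 0 1 3) ∷ []) ∷
  entry 2 ((0 , 1) ∷ []) [] (just (0 , 16)) ((0 , 2 , 0) ∷ (1 , 5 , 1) ∷ [])
    (draw 2 3 22 (0 ∷ 1 ∷ 2 ∷ 3 ∷ []) (goto 24 (0 ∷ 1 ∷ 2 ∷ 3 ∷ [])) ∷ draw 0 2 2 (1 ∷ 2 ∷ []) (goto 3 (1 ∷ 0 ∷ 2 ∷ [])) ∷ []) ∷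
  entry 3 ((0 , 1) ∷ []) ((1 , 2) ∷ []) (just (0 , 15)) ((0 , 2 , 0) ∷ (2 , 6 , 0) ∷ (4 , 8 , 1) ∷ [])
    (draw 1 3 2 (0 ∷ 3 ∷ []) (goto 8 (1 ∷ 0 ∷ 3 ∷ 2 ∷ [])) ∷ draw 0 3 3 (3 ∷ 1 ∷ 2 ∷ []) (goto 14 (1 ∷ 0 ∷ 3 ∷ 2 ∷ [])) ∷ []) ∷
  entry 2 ((0 , 0) ∷ (1 , 1) ∷ []) ((0 , 1) ∷ []) (just (3 , 11)) []
    (draw 0 2 11 (2 ∷ 0 ∷ 1 ∷ []) (goto 7 (0 ∷ 1 ∷ 2 ∷ [])) ∷ []) ∷
  entry 5 ((0 , 1) ∷ []) ((0 , 2) ∷ (3 , 1) ∷ (3 , 4) ∷ []) (just (4 , 12)) ((0 , 2 , 0) ∷ (1 , 3 , 1) ∷ (2 , 5 , 0) ∷ [])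
    (draw 5 6 26 (5 ∷ 6 ∷ 0 ∷ 1 ∷ 2 ∷ 3 ∷ 4 ∷ []) (goto 27 (0 ∷ 5 ∷ 6 ∷ 1 ∷ 2 ∷ 3 ∷ 4 ∷ [])) ∷ draw 1 5 2 (0 ∷ 5 ∷ []) (win 4 3 1 5) ∷ []) ∷
  entry 4 ((1 , 2) ∷ (0 , 0) ∷ []) ((0 , 2) ∷ (0 , 3) ∷ []) (just (0 , 12)) []
    (draw 2 4 10 (1 ∷ 4 ∷ 0 ∷ 2 ∷ []) (win 3 0 2 4) ∷ []) ∷
  entry 3 ((0 , 0) ∷ (1 , 1) ∷ (2 , 2) ∷ []) ((0 , 1) ∷ (0 , 2) ∷ []) (just (3 , 6)) []
    (draw 1 3 16 (0 ∷ 3 ∷ 1 ∷ 2 ∷ []) (win 2 0 1 3) ∷ []) ∷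
  entry 4 ((0 , 1) ∷ (2 , 2) ∷ []) ((0 , 2) ∷ (0 , 3) ∷ []) (just (0 , 10)) ((4 , 8 , 0) ∷ [])
    (draw 1 2 1 (0 ∷ 2 ∷ 3 ∷ []) (win 1 2 0 3) ∷ []) ∷
  entry 3 ((0 , 1) ∷ (2 , 2) ∷ []) ((0 , 1) ∷ (0 , 2) ∷ []) (just (0 , 8)) ((5 , 9 , 0) ∷ [])
    (draw 1 3 8 (0 ∷ 3 ∷ 2 ∷ 1 ∷ []) (win 2 0 1 3) ∷ []) ∷
  entry 4 ((0 , 1) ∷ (2 , 2) ∷ []) ((2 , 3) ∷ []) (just (0 , 14)) ((1 , 4 , 1) ∷ (2 , 5 , 2) ∷ [])
    (draw 4 5 39 (0 ∷ 1 ∷ 4 ∷ 5 ∷ 2 ∷ 3 ∷ []) (goto 43 (0 ∷ 1 ∷ 2 ∷ 4 ∷ 5 ∷ 3 ∷ [])) ∷ draw 0 2 3 (1 ∷ 2 ∷ 3 ∷ []) (goto 6 (2 ∷ 1 ∷ 0 ∷ 3 ∷ [])) ∷ draw 2 4 23 (0 ∷ 1 ∷ 4 ∷ 2 ∷ 3 ∷ []) (goto 15 (2 ∷ 0 ∷ 1 ∷ 4 ∷ 3 ∷ [])) ∷ []) ∷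
  entry 3 ((0 , 1) ∷ (2 , 2) ∷ []) ((1 , 2) ∷ []) (just (2 , 12)) ((6 , 11 , 0) ∷ [])
    (draw 1 3 10 (0 ∷ 3 ∷ 2 ∷ 1 ∷ []) (goto 19 (1 ∷ 0 ∷ 2 ∷ 3 ∷ [])) ∷ []) ∷
  entry 5 ((0 , 1) ∷ (2 , 2) ∷ []) ((1 , 3) ∷ (2 , 4) ∷ []) (just (1 , 13)) ((1 , 3 , 1) ∷ [])
    (draw 1 5 10 (0 ∷ 5 ∷ 2 ∷ 4 ∷ []) (goto 18 (1 ∷ 0 ∷ 2 ∷ 5 ∷ 3 ∷ 4 ∷ [])) ∷ draw 1 2 2 (0 ∷ 2 ∷ []) (win 3 1 2 4) ∷ []) ∷
  entry 6 ((0 , 1) ∷ (2 , 2) ∷ []) ((1 , 3) ∷ (4 , 2) ∷ (4 , 5) ∷ []) (just (5 , 10)) ((0 , 2 , 0) ∷ (1 , 3 , 0) ∷ (2 , 4 , 0) ∷ (3 , 6 , 0) ∷ [])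
    (draw 0 2 5 (1 ∷ 2 ∷ 3 ∷ 4 ∷ 5 ∷ []) (win 0 2 4 5) ∷ []) ∷
  entry 4 ((0 , 1) ∷ (2 , 2) ∷ []) ((0 , 3) ∷ (1 , 2) ∷ []) (just (1 , 11)) ((1 , 3 , 1) ∷ (6 , 10 , 2) ∷ [])
    (draw 1 4 12 (4 ∷ 0 ∷ 2 ∷ 3 ∷ 1 ∷ []) (goto 19 (1 ∷ 0 ∷ 2 ∷ 4 ∷ [])) ∷ draw 0 2 2 (1 ∷ 2 ∷ []) (win 1 2 0 3) ∷ draw 2 4 56 (4 ∷ 0 ∷ 2 ∷ 1 ∷ 3 ∷ []) (goto 53 (2 ∷ 0 ∷ 1 ∷ 4 ∷ 3 ∷ [])) ∷ []) ∷
  entry 5 ((1 , 2) ∷ (0 , 0) ∷ (3 , 3) ∷ []) ((0 , 3) ∷ (0 , 4) ∷ []) (just (0 , 10)) []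
    (draw 1 3 6 (0 ∷ 2 ∷ 3 ∷ 4 ∷ []) (win 1 3 0 4) ∷ []) ∷
  entry 4 ((1 , 2) ∷ (0 , 0) ∷ (3 , 3) ∷ []) ((0 , 2) ∷ (0 , 3) ∷ []) (just (1 , 8)) []
    (draw 2 4 15 (0 ∷ 1 ∷ 4 ∷ 3 ∷ 2 ∷ []) (win 3 0 2 4) ∷ []) ∷
  entry 6 ((1 , 3) ∷ (0 , 0) ∷ (2 , 2) ∷ []) ((0 , 3) ∷ (0 , 4) ∷ (2 , 5) ∷ []) (just (0 , 10)) ((1 , 3 , 1) ∷ (2 , 4 , 2) ∷ [])
    (draw 6 7 42 (6 ∷ 7 ∷ 1 ∷ 2 ∷ 3 ∷ 5 ∷ 0 ∷ 4 ∷ []) (goto 46 (0 ∷ 1 ∷ 2 ∷ 6 ∷ 7 ∷ 3 ∷ 4 ∷ 5 ∷ [])) ∷ draw 3 6 10 (1 ∷ 6 ∷ 0 ∷ 3 ∷ []) (win 4 0 3 6) ∷ draw 2 3 12 (1 ∷ 2 ∷ 0 ∷ 5 ∷ 3 ∷ []) (win 0 3 2 5) ∷ []) ∷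
  entry 6 ((0 , 1) ∷ (2 , 2) ∷ (3 , 3) ∷ []) ((0 , 3) ∷ (0 , 4) ∷ (2 , 5) ∷ []) (just (1 , 8)) ((5 , 8 , 1) ∷ [])
    (draw 0 2 13 (1 ∷ 2 ∷ 3 ∷ 5 ∷ 0 ∷ 4 ∷ []) (win 3 0 2 5) ∷ draw 3 6 57 (0 ∷ 1 ∷ 6 ∷ 2 ∷ 3 ∷ 4 ∷ 5 ∷ []) (win 4 0 3 6) ∷ []) ∷
  entry 4 ((0 , 1) ∷ (2 , 2) ∷ (3 , 3) ∷ []) ((0 , 2) ∷ (0 , 3) ∷ []) (just (1 , 6)) ((1 , 3 , 0) ∷ (6 , 10 , 0) ∷ [])
    (draw 1 2 9 (0 ∷ 2 ∷ 3 ∷ []) (win 1 2 0 3) ∷ []) ∷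
  entry 5 ((0 , 3) ∷ (1 , 2) ∷ []) ((0 , 3) ∷ (0 , 4) ∷ []) (just (1 , 13)) ((3 , 7 , 0) ∷ [])
    (draw 1 3 3 (2 ∷ 0 ∷ 3 ∷ []) (win 1 3 0 4) ∷ []) ∷
  entry 5 ((0 , 3) ∷ (1 , 1) ∷ (2 , 2) ∷ []) ((0 , 3) ∷ (0 , 4) ∷ (1 , 2) ∷ []) (just (2 , 7)) ((2 , 4 , 1) ∷ (3 , 6 , 0) ∷ [])
    (draw 1 5 38 (0 ∷ 5 ∷ 1 ∷ 2 ∷ 3 ∷ 4 ∷ []) (goto 37 (0 ∷ 1 ∷ 3 ∷ 2 ∷ 5 ∷ 4 ∷ [])) ∷ draw 0 1 14 (3 ∷ 1 ∷ 2 ∷ 0 ∷ []) (win 2 1 0 3) ∷ []) ∷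
  -- Two blue paths. If the usual move, lengthening one of them, is answered in blue, the same entry
  -- applies again. Such loops are possible because patterns forget the lengths of paths.
  entry 4 ((0 , 1) ∷ (2 , 3) ∷ []) [] (just (1 , 18)) ((1 , 5 , 1) ∷ [])
    (draw 0 4 22 (1 ∷ 4 ∷ 2 ∷ 3 ∷ []) (goto 40 (2 ∷ 3 ∷ 1 ∷ 0 ∷ 4 ∷ [])) ∷ draw 0 2 2 (1 ∷ 3 ∷ []) (goto 55 (1 ∷ 3 ∷ 0 ∷ 2 ∷ [])) ∷ []) ∷
  entry 5 ((0 , 1) ∷ (2 , 3) ∷ []) ((3 , 4) ∷ []) (just (1 , 16)) ((1 , 4 , 1) ∷ (4 , 9 , 0) ∷ [])
    (draw 3 5 22 (0 ∷ 1 ∷ 2 ∷ 5 ∷ []) (goto 35 (3 ∷ 2 ∷ 0 ∷ 1 ∷ 5 ∷ 4 ∷ [])) ∷ draw 0 2 3 (1 ∷ 3 ∷ 4 ∷ []) (goto 56 (1 ∷ 3 ∷ 0 ∷ 2 ∷ 4 ∷ [])) ∷ []) ∷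
  entry 4 ((0 , 1) ∷ (2 , 2) ∷ (3 , 3) ∷ []) ((2 , 3) ∷ []) (just (2 , 11)) []
    (draw 2 4 40 (0 ∷ 1 ∷ 4 ∷ 2 ∷ 3 ∷ []) (goto 29 (2 ∷ 0 ∷ 1 ∷ 3 ∷ 4 ∷ [])) ∷ []) ∷
  entry 6 ((0 , 1) ∷ (2 , 2) ∷ (3 , 3) ∷ []) ((2 , 4) ∷ (3 , 5) ∷ []) (just (1 , 13)) ((1 , 4 , 1) ∷ [])
    (draw 2 6 41 (0 ∷ 1 ∷ 6 ∷ 2 ∷ 3 ∷ 4 ∷ 5 ∷ []) (goto 28 (2 ∷ 0 ∷ 1 ∷ 3 ∷ 6 ∷ 4 ∷ 5 ∷ [])) ∷ draw 0 6 2 (1 ∷ 6 ∷ []) (goto 12 (1 ∷ 0 ∷ 2 ∷ 6 ∷ 4 ∷ [])) ∷ []) ∷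
  entry 7 ((0 , 1) ∷ (2 , 3) ∷ []) ((2 , 4) ∷ (5 , 3) ∷ (5 , 6) ∷ []) (just (1 , 13)) ((3 , 7 , 0) ∷ [])
    (draw 0 3 3 (1 ∷ 2 ∷ 4 ∷ []) (win 0 3 5 6) ∷ []) ∷
  entry 7 ((0 , 3) ∷ (1 , 1) ∷ (2 , 2) ∷ []) ((0 , 4) ∷ (1 , 2) ∷ (5 , 3) ∷ (5 , 6) ∷ []) (just (4 , 7)) ((2 , 4 , 1) ∷ [])
    (draw 1 7 44 (7 ∷ 0 ∷ 1 ∷ 2 ∷ 3 ∷ 4 ∷ 5 ∷ 6 ∷ []) (goto 34 (1 ∷ 0 ∷ 3 ∷ 2 ∷ 7 ∷ 4 ∷ 5 ∷ 6 ∷ [])) ∷ draw 0 1 5 (1 ∷ 3 ∷ 2 ∷ 5 ∷ 6 ∷ []) (win 2 1 0 4) ∷ []) ∷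
  entry 7 ((1 , 2) ∷ (0 , 0) ∷ (3 , 3) ∷ (4 , 4) ∷ []) ((0 , 4) ∷ (0 , 5) ∷ (3 , 6) ∷ []) (just (1 , 8)) []
    (draw 1 4 17 (0 ∷ 2 ∷ 3 ∷ 4 ∷ 5 ∷ 6 ∷ []) (win 1 4 0 5) ∷ []) ∷
  entry 5 ((1 , 2) ∷ (0 , 0) ∷ (3 , 3) ∷ (4 , 4) ∷ []) ((0 , 3) ∷ (0 , 4) ∷ []) (just (2 , 6)) []
    (draw 1 3 16 (0 ∷ 2 ∷ 3 ∷ 4 ∷ []) (win 1 3 0 4) ∷ []) ∷
  entry 6 ((1 , 2) ∷ (0 , 0) ∷ (3 , 3) ∷ (4 , 4) ∷ []) ((0 , 3) ∷ (0 , 4) ∷ (2 , 5) ∷ []) (just (2 , 4)) ((2 , 4 , 0) ∷ (7 , 10 , 1) ∷ [])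
    (draw 0 2 19 (0 ∷ 1 ∷ 3 ∷ 4 ∷ []) (win 3 0 2 5) ∷ draw 1 3 53 (0 ∷ 2 ∷ 3 ∷ 4 ∷ 5 ∷ []) (win 1 3 0 4) ∷ []) ∷
  entry 7 ((1 , 3) ∷ (2 , 4) ∷ (0 , 0) ∷ []) ((0 , 4) ∷ (0 , 5) ∷ (3 , 6) ∷ []) (just (2 , 11)) []
    (draw 1 4 12 (2 ∷ 3 ∷ 0 ∷ 6 ∷ 4 ∷ []) (win 1 4 0 5) ∷ []) ∷
  entry 6 ((1 , 3) ∷ (0 , 0) ∷ (2 , 2) ∷ (4 , 4) ∷ []) ((0 , 3) ∷ (0 , 4) ∷ (2 , 5) ∷ []) (just (2 , 6)) []
    (draw 3 6 28 (0 ∷ 1 ∷ 6 ∷ 2 ∷ 4 ∷ 3 ∷ 5 ∷ []) (win 4 0 3 6) ∷ []) ∷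
  entry 6 ((1 , 4) ∷ (2 , 3) ∷ (0 , 0) ∷ []) ((0 , 4) ∷ (0 , 5) ∷ (2 , 3) ∷ []) (just (1 , 9)) ((1 , 3 , 1) ∷ (2 , 4 , 2) ∷ [])
    (draw 2 6 31 (0 ∷ 6 ∷ 1 ∷ 3 ∷ 4 ∷ 5 ∷ 2 ∷ []) (goto 49 (2 ∷ 0 ∷ 1 ∷ 4 ∷ 3 ∷ 6 ∷ 5 ∷ [])) ∷ draw 2 4 3 (1 ∷ 3 ∷ 2 ∷ []) (win 0 4 2 3) ∷ draw 2 4 12 (1 ∷ 3 ∷ 0 ∷ 2 ∷ 4 ∷ []) (win 0 4 2 3) ∷ []) ∷
  entry 8 ((1 , 2) ∷ (0 , 0) ∷ (3 , 3) ∷ (4 , 4) ∷ []) ((0 , 3) ∷ (0 , 4) ∷ (1 , 5) ∷ (6 , 2) ∷ (6 , 7) ∷ []) (just (4 , 2)) []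
    (draw 2 8 30 (0 ∷ 8 ∷ 1 ∷ 3 ∷ 4 ∷ 5 ∷ []) (win 7 6 2 8) ∷ []) ∷
  entry 6 ((0 , 1) ∷ (2 , 3) ∷ (4 , 4) ∷ []) ((0 , 4) ∷ (0 , 5) ∷ []) (just (2 , 11)) ((4 , 8 , 0) ∷ [])
    (draw 1 4 20 (0 ∷ 2 ∷ 3 ∷ 4 ∷ 5 ∷ []) (win 1 4 0 5) ∷ []) ∷
  entry 5 ((0 , 1) ∷ (2 , 3) ∷ (4 , 4) ∷ []) ((0 , 3) ∷ (0 , 4) ∷ []) (just (1 , 8)) ((5 , 9 , 0) ∷ [])
    (draw 1 3 8 (0 ∷ 2 ∷ 4 ∷ 3 ∷ []) (win 1 3 0 4) ∷ []) ∷
  entry 6 ((0 , 2) ∷ (1 , 1) ∷ (3 , 3) ∷ (4 , 4) ∷ []) ((0 , 2) ∷ (0 , 5) ∷ (1 , 3) ∷ (1 , 4) ∷ []) (just (3 , 2)) ((3 , 5 , 0) ∷ [])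
    (draw 2 6 30 (1 ∷ 6 ∷ 0 ∷ 3 ∷ 4 ∷ 2 ∷ []) (win 5 0 2 6) ∷ []) ∷
  entry 6 ((0 , 4) ∷ (1 , 2) ∷ (3 , 3) ∷ []) ((0 , 4) ∷ (0 , 5) ∷ (2 , 3) ∷ []) (just (2 , 9)) []
    (draw 1 4 14 (0 ∷ 2 ∷ 3 ∷ 4 ∷ []) (win 1 4 0 5) ∷ []) ∷
  entry 6 ((0 , 1) ∷ (2 , 3) ∷ (4 , 4) ∷ []) ((4 , 5) ∷ []) (just (2 , 16)) []
    (draw 0 6 22 (1 ∷ 6 ∷ 2 ∷ 3 ∷ []) (goto 51 (2 ∷ 3 ∷ 1 ∷ 0 ∷ 4 ∷ 6 ∷ 5 ∷ [])) ∷ []) ∷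
  entry 5 ((0 , 1) ∷ (2 , 3) ∷ (4 , 4) ∷ []) ((3 , 4) ∷ []) (just (1 , 13)) ((5 , 9 , 1) ∷ [])
    (draw 0 3 10 (1 ∷ 2 ∷ 4 ∷ 3 ∷ []) (goto 36 (3 ∷ 2 ∷ 1 ∷ 0 ∷ 4 ∷ [])) ∷ draw 3 5 39 (0 ∷ 1 ∷ 2 ∷ 5 ∷ 4 ∷ 3 ∷ []) (goto 58 (3 ∷ 2 ∷ 0 ∷ 1 ∷ 4 ∷ 5 ∷ [])) ∷ []) ∷
  entry 7 ((0 , 1) ∷ (2 , 3) ∷ (4 , 4) ∷ []) ((3 , 5) ∷ (4 , 6) ∷ []) (just (1 , 14)) ((1 , 4 , 1) ∷ (5 , 10 , 0) ∷ [])
    (draw 3 4 23 (0 ∷ 1 ∷ 2 ∷ 4 ∷ 6 ∷ []) (win 5 3 4 6) ∷ draw 0 2 3 (1 ∷ 3 ∷ 5 ∷ []) (goto 56 (1 ∷ 3 ∷ 0 ∷ 2 ∷ 5 ∷ [])) ∷ []) ∷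
  entry 8 ((0 , 1) ∷ (2 , 4) ∷ (3 , 3) ∷ []) ((3 , 5) ∷ (6 , 4) ∷ (6 , 7) ∷ []) (just (2 , 12)) []
    (draw 0 4 10 (1 ∷ 2 ∷ 3 ∷ 5 ∷ []) (win 0 4 6 7) ∷ []) ∷
  entry 6 ((0 , 1) ∷ (2 , 2) ∷ (3 , 3) ∷ (4 , 4) ∷ []) ((2 , 5) ∷ (3 , 4) ∷ []) (just (3 , 9)) []
    (draw 3 6 51 (0 ∷ 1 ∷ 6 ∷ 3 ∷ 2 ∷ 4 ∷ 5 ∷ []) (goto 45 (3 ∷ 0 ∷ 1 ∷ 2 ∷ 4 ∷ 6 ∷ 5 ∷ [])) ∷ []) ∷
  entry 8 ((0 , 2) ∷ (1 , 4) ∷ (3 , 3) ∷ []) ((1 , 5) ∷ (2 , 3) ∷ (6 , 4) ∷ (6 , 7) ∷ []) (just (3 , 9)) []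
    (draw 0 4 14 (1 ∷ 2 ∷ 3 ∷ 5 ∷ []) (win 0 4 6 7) ∷ []) ∷
  entry 7 ((1 , 2) ∷ (0 , 0) ∷ (3 , 3) ∷ (4 , 4) ∷ (5 , 5) ∷ []) ((0 , 4) ∷ (0 , 5) ∷ (3 , 6) ∷ []) (just (3 , 4)) []
    (draw 1 4 32 (0 ∷ 2 ∷ 3 ∷ 4 ∷ 5 ∷ 6 ∷ []) (win 1 4 0 5) ∷ []) ∷
  entry 8 ((1 , 5) ∷ (0 , 0) ∷ (2 , 2) ∷ (3 , 3) ∷ (4 , 4) ∷ []) ((0 , 5) ∷ (0 , 6) ∷ (2 , 7) ∷ (3 , 4) ∷ []) (just (3 , 5)) []
    (draw 2 3 47 (0 ∷ 1 ∷ 2 ∷ 3 ∷ 4 ∷ 5 ∷ 6 ∷ 7 ∷ []) (win 4 3 2 7) ∷ []) ∷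
  entry 8 ((1 , 5) ∷ (2 , 3) ∷ (0 , 0) ∷ (4 , 4) ∷ []) ((0 , 5) ∷ (0 , 6) ∷ (2 , 7) ∷ (3 , 4) ∷ []) (just (2 , 7)) []
    (draw 2 4 33 (0 ∷ 1 ∷ 3 ∷ 4 ∷ 5 ∷ 6 ∷ []) (win 3 4 2 7) ∷ []) ∷
  entry 7 ((0 , 1) ∷ (2 , 4) ∷ (3 , 3) ∷ (5 , 5) ∷ []) ((0 , 4) ∷ (0 , 5) ∷ (3 , 6) ∷ []) (just (2 , 6)) []
    (draw 1 4 18 (0 ∷ 2 ∷ 3 ∷ 5 ∷ 4 ∷ 6 ∷ []) (win 1 4 0 5) ∷ []) ∷
  entry 7 ((0 , 4) ∷ (2 , 3) ∷ (1 , 1) ∷ (5 , 5) ∷ []) ((0 , 4) ∷ (0 , 5) ∷ (1 , 3) ∷ (1 , 6) ∷ []) (just (3 , 4)) []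
    (draw 3 7 50 (0 ∷ 2 ∷ 7 ∷ 1 ∷ 4 ∷ 5 ∷ 3 ∷ []) (win 6 1 3 7) ∷ []) ∷
  entry 7 ((0 , 4) ∷ (1 , 2) ∷ (3 , 3) ∷ (5 , 5) ∷ []) ((0 , 4) ∷ (0 , 5) ∷ (3 , 6) ∷ []) (just (2 , 6)) []
    (draw 1 4 18 (0 ∷ 2 ∷ 3 ∷ 5 ∷ 4 ∷ 6 ∷ []) (win 1 4 0 5) ∷ []) ∷
  entry 7 ((0 , 1) ∷ (2 , 3) ∷ (4 , 4) ∷ (5 , 5) ∷ []) ((3 , 5) ∷ (4 , 6) ∷ []) (just (2 , 11)) []
    (draw 0 3 25 (1 ∷ 2 ∷ 4 ∷ 5 ∷ 6 ∷ 3 ∷ []) (goto 48 (3 ∷ 2 ∷ 1 ∷ 4 ∷ 0 ∷ 5 ∷ 6 ∷ [])) ∷ []) ∷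
  -- The remaining entries have no linear budget; they serve only particular values of `m` below the
  -- horizon.
  entry 6 ((1 , 2) ∷ (0 , 0) ∷ (3 , 3) ∷ []) ((0 , 3) ∷ (0 , 4) ∷ (2 , 5) ∷ []) nothing ((5 , 8 , 0) ∷ [])
    (draw 3 6 31 (0 ∷ 1 ∷ 6 ∷ 2 ∷ 3 ∷ 4 ∷ 5 ∷ []) (win 4 0 3 6) ∷ []) ∷
  entry 5 ((1 , 2) ∷ (0 , 0) ∷ (3 , 3) ∷ []) ((0 , 2) ∷ (0 , 3) ∷ (1 , 4) ∷ []) nothing ((6 , 9 , 0) ∷ [])
    (draw 2 5 52 (0 ∷ 5 ∷ 1 ∷ 3 ∷ 2 ∷ 4 ∷ []) (win 3 0 2 5) ∷ []) ∷
  entry 4 ((0 , 1) ∷ (2 , 3) ∷ []) ((0 , 2) ∷ (0 , 3) ∷ []) nothing ((1 , 3 , 0) ∷ [])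
    (draw 1 2 1 (0 ∷ 3 ∷ 2 ∷ []) (win 1 2 0 3) ∷ []) ∷
  entry 4 ((0 , 2) ∷ (1 , 3) ∷ []) ((2 , 3) ∷ []) nothing ((1 , 4 , 0) ∷ [])
    (draw 0 3 3 (1 ∷ 2 ∷ 3 ∷ []) (goto 54 (3 ∷ 1 ∷ 0 ∷ 2 ∷ [])) ∷ []) ∷
  entry 5 ((0 , 2) ∷ (1 , 3) ∷ []) ((1 , 4) ∷ (2 , 3) ∷ []) nothing ((1 , 3 , 0) ∷ (5 , 9 , 0) ∷ [])
    (draw 1 2 3 (0 ∷ 3 ∷ 2 ∷ []) (win 3 2 1 4) ∷ []) ∷
  entry 7 ((0 , 1) ∷ (2 , 4) ∷ (3 , 3) ∷ []) ((0 , 4) ∷ (0 , 5) ∷ (3 , 6) ∷ []) nothing ((4 , 7 , 0) ∷ [])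
    (draw 1 4 12 (2 ∷ 0 ∷ 3 ∷ 4 ∷ 6 ∷ []) (win 1 4 0 5) ∷ []) ∷
  entry 6 ((0 , 1) ∷ (2 , 3) ∷ (4 , 4) ∷ (5 , 5) ∷ []) ((0 , 4) ∷ (0 , 5) ∷ []) nothing ((5 , 8 , 0) ∷ [])
    (draw 2 4 36 (0 ∷ 1 ∷ 3 ∷ 4 ∷ 5 ∷ []) (win 2 4 0 5) ∷ []) ∷ []

-- The upper bound

open Table strategy

-- `from-just` has the required type only if the check evaluates to `just`, so type checking itself
-- verifies the table. The same holds for `strategy-affordable`.
strategy-sound : All EntrySound strategy
strategy-sound = from-just (allMaybe entrySound? strategy)

strategy-affordable : All BudgetSound strategy
strategy-affordable = from-just (allMaybe budgetSound? strategy)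

empty-board : Realises [] id (pattern-at 0) 0
empty-board = record
  { injective = id
  ; vertices  = []
  ; family    = []
  ; unique    = []
  ; redEdges  = []
  ; unused    = λ _ ()
  ; fresh     = λ { _ _ (_ , inj₁ ()) ; _ _ (_ , inj₂ ()) }
  ; apart     = λ ()
  }

opening-budget : ∀ ℓ → 3 ≤ ℓ → Within 0 ℓ (2 + (7 * ℓ + 2 + 4) / 5)
opening-budget ℓ 3≤ℓ = (7 * ℓ + 16) / 5 , 0 , planned , ≤-reflexive (begin
  (7 * ℓ + 16) / 5                ≡⟨ cong (_/ 5) (split ℓ) ⟩
  (5 + (5 + (7 * ℓ + 2 + 4))) / 5 ≡⟨ [5+x]/5≡1+x/5 (5 + (7 * ℓ + 2 + 4)) ⟩
  suc ((5 + (7 * ℓ + 2 + 4)) / 5) ≡⟨ cong suc ([5+x]/5≡1+x/5 (7 * ℓ + 2 + 4)) ⟩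
  2 + (7 * ℓ + 2 + 4) / 5         ∎)
  where
  open ≡-Reasoning
  split : ∀ ℓ → 7 * ℓ + 16 ≡ 5 + (5 + (7 * ℓ + 2 + 4))
  split = solve-∀
  planned : plan (at 0) ℓ ≡ just ((7 * ℓ + 16) / 5 , 0)
  planned with does (ℓ <? horizon)
  ... | true  = planUsual-≤ 16 3≤ℓ
  ... | false = planUsual-≤ 16 3≤ℓ

upper-bound : ∀ ℓ → 3 ≤ ℓ → BuilderWinsWithin (Path 4) (Path (suc ℓ)) ((7 * ℓ + 2 + 4) / 5) []
upper-bound ℓ 3≤ℓ = wins strategy-sound strategy-affordable ℓ _ 0 ℓ (opening-budget ℓ 3≤ℓ) empty-board ≤-refl

theorem1p3 : ∀ (ℓ : ℕ) → 3 ≤ ℓ →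
    IsOnlineRamseyNumber (Path 4) (Path (suc ℓ)) ((7 * ℓ + 2 + 4) / 5)
theorem1p3 ℓ 3≤ℓ = upper-bound ℓ 3≤ℓ , lower-bound ℓ 3≤ℓ
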